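{- Let $q$ be a prime power. For $n\in\{2,3\}$, the orbitals of $GU(n,q)$ acting on $\Phi(n,q)$ are exactly the $2(q^2-1)$ sets $S_{\alpha^i}$ and $R_{\alpha^i}$, $0\le i\le q^2-2$. For $n\ge 4$, the orbitals are exactly these sets together with $T$. Consequently the rank of the permutation group $(GU(n,q),\Phi(n,q))$ (equivalently, the number of relations of the Schurian association scheme $\mathcal X(GU(n,q),\Phi(n,q))$) is $2q^2-2$ if $n\in\{2,3\}$ and $2q^2-1$ if $n\ge 4$.
   Context: Let $q$ be a prime power, $V=\mathbb{F}_{q^2}^n$ with Hermitian form $\langle x,y\rangle=\sum_{k=1}^n x_k y_k^{\,q}$, $GU(n,q)=\{U\in GL_n(\mathbb{F}_{q^2}):U\bar U^T=I\}$ ($\bar U$ = entrywise $q$-th power) acting on the right on $V$, and on pairs by $(x,y)U=(xU,yU)$. $\Phi=\Phi(n,q)=\{x\in V\setminus\{0\}:\langle x,x\rangle=0\}$. An orbital is an orbit of the group on $\Phi\times\Phi$; the orbitals of a transitive group form the relations of the Schurian association scheme $\mathcal X(G,\Phi)$. Fix a primitive element $\alpha$ of $\mathbb{F}_{q^2}$; for $0\le i\le q^2-2$ let $S_{\alpha^i}=\{(x,y)\in\Phi\times\Phi:y=\alpha^ix\}$, $R_{\alpha^i}=\{(x,y)\in\Phi\times\Phi:\langle x,y\rangle=\alpha^i\}$, and $T=\{(x,y)\in\Phi\times\Phi:\langle x,y\rangle=0,\ y\notin\mathrm{Span}\{x\}\}$. -}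

module Defs where

open import Level using (Level; _⊔_) renaming (suc to lsuc)
open import Algebra.Bundles using (CommutativeRing)
import Algebra.Definitions as AlgDefs
import Algebra.Properties.Semiring.Exp as Exp
import Algebra.Properties.Semiring.Sum as Sum
open import Data.Fin.Base using (Fin; toℕ)
import Data.Fin.Properties as Fin
open import Data.Nat.Base using (ℕ; suc; _∸_) renaming (_^_ to _^ℕ_)
open import Data.Nat.Primality using (Prime)
open import Data.Bool.Base using (if_then_else_)
open import Data.Product.Base using (Σ; ∃-syntax; _×_; _,_; proj₁)
open import Data.Sum.Base using (_⊎_; [_,_]′)
open import Data.Unit.Base using (⊤)
open import Data.Vec.Functional using (Vector)
import Data.Vec.Functional.Relation.Binary.Equality.Setoid as VecEq
open import Function.Base using (const)
open import Function.Bundles using (Inverse)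
open import Relation.Binary.Bundles using (Setoid)
open import Relation.Binary.PropositionalEquality.Core using (_≡_)
import Relation.Binary.PropositionalEquality.Properties as ≡
open import Relation.Nullary.Decidable.Core using (does)
open import Relation.Nullary.Negation.Core using (¬_)
open import Relation.Unary using (Pred; _≐_)
open import Relation.Unary.Properties using (≐-refl; ≐-sym; ≐-trans)

IsPrimePower : ℕ → Set
IsPrimePower q = ∃[ p ] ∃[ k ] (Prime p × q ≡ p ^ℕ suc k)

HasCardinality : ∀ {a b} → Setoid a b → ℕ → Set (a ⊔ b)
HasCardinality S m = Inverse S (≡.setoid (Fin m))

record FiniteField (ℓ : Level) (m : ℕ) : Set (lsuc ℓ) where
  field
    commutativeRing : CommutativeRing ℓ ℓ

  open CommutativeRing commutativeRing public
  open AlgDefs _≈_ using (Invertible)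
  open Exp semiring public using (_^_)

  field
    1≉0        : ¬ 1# ≈ 0#
    invertible : ∀ x → ¬ x ≈ 0# → Invertible 1# _*_ x
    order      : HasCardinality setoid m

  IsPrimitive : Carrier → Set ℓ
  IsPrimitive α = ¬ α ≈ 0# × (∀ x → ¬ x ≈ 0# → ∃[ k ] x ≈ α ^ k)

module Unitary {ℓ : Level} (q : ℕ) (F : FiniteField ℓ (q ^ℕ 2)) (n : ℕ) where

  open FiniteField F
  open Sum semiring using (sum)
  open VecEq setoid using (_≋_)

  V : Set ℓ
  V = Vector Carrier n

  0ᵛ : V
  0ᵛ _ = 0#

  infixr 7 _·ᵛ_
  _·ᵛ_ : Carrier → V → V
  (c ·ᵛ x) k = c * x k

  conj : Carrier → Carrier
  conj x = x ^ q

  ⟨_,_⟩ : V → V → Carrier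
  ⟨ x , y ⟩ = sum λ k → x k * conj (y k)

  Matrix : Set ℓ
  Matrix = Fin n → Fin n → Carrier

  infix 4 _≈ᴹ_
  _≈ᴹ_ : Matrix → Matrix → Set ℓ
  A ≈ᴹ B = ∀ i j → A i j ≈ B i j

  infixl 7 _*ᴹ_
  _*ᴹ_ : Matrix → Matrix → Matrix
  (A *ᴹ B) i j = sum λ k → A i k * B k j

  1ᴹ : Matrix
  1ᴹ i j = if does (i Fin.≟ j) then 1# else 0#

  conjTranspose : Matrix → Matrix
  conjTranspose A i j = conj (A j i)

  record GU : Set ℓ where
    field
      matrix     : Matrix
      invertible : AlgDefs.Invertible _≈ᴹ_ 1ᴹ _*ᴹ_ matrix
      unitary    : matrix *ᴹ conjTranspose matrix ≈ᴹ 1ᴹ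

  infixl 7 _·_
  _·_ : V → GU → V
  (x · U) j = sum λ k → x k * GU.matrix U k j

  Φ : Set ℓ
  Φ = Σ V λ x → ¬ x ≋ 0ᵛ × ⟨ x , x ⟩ ≈ 0#

  IsTransitive : Set ℓ
  IsTransitive = ∀ ((x , _) (y , _) : Φ) → ∃[ U ] x · U ≋ y

  Relation : Set (lsuc ℓ)
  Relation = Pred (Φ × Φ) ℓ

  orbit : Φ × Φ → Relation
  orbit ((x , _) , (y , _)) ((x′ , _) , (y′ , _)) =
    ∃[ U ] (x · U ≋ x′ × y · U ≋ y′)

  IsOrbital : Relation → Set ℓ
  IsOrbital O = ∃[ p ] O ≐ orbit p

  -- Equality of orbitals is equality as subsets of Φ × Φ.  When the action is
  -- transitive these are the relations of the Schurian association scheme.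
  orbitals : Setoid (lsuc ℓ) ℓ
  orbitals = record
    { Carrier       = Σ Relation IsOrbital
    ; _≈_           = λ O O′ → proj₁ O ≐ proj₁ O′
    ; isEquivalence = record { refl = ≐-refl ; sym = ≐-sym ; trans = ≐-trans }
    }

  HasRank : ℕ → Set (lsuc ℓ)
  HasRank = HasCardinality orbitals

  record OrbitalsAreExactly {I : Set} (A : I → Relation) : Set (lsuc ℓ) where
    field
      isOrbital : ∀ i → IsOrbital (A i)
      complete  : ∀ O → IsOrbital O → ∃[ i ] O ≐ A i
      distinct  : ∀ i j → A i ≐ A j → i ≡ j

  S : Carrier → Relation
  S c ((x , _) , (y , _)) = y ≋ c ·ᵛ x

  R : Carrier → Relation
  R c ((x , _) , (y , _)) = ⟨ x , y ⟩ ≈ c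

  T : Relation
  T ((x , _) , (y , _)) = ⟨ x , y ⟩ ≈ 0# × ¬ (∃[ c ] y ≋ c ·ᵛ x)

  Exponent : Set
  Exponent = Fin (q ^ℕ 2 ∸ 1)

  S∪R : Carrier → Exponent ⊎ Exponent → Relation
  S∪R α = [ (λ i → S (α ^ toℕ i)) , (λ i → R (α ^ toℕ i)) ]′

  S∪R∪T : Carrier → (Exponent ⊎ Exponent) ⊎ ⊤ → Relation
  S∪R∪T α = [ S∪R α , const T ]′

{-# OPTIONS --safe #-}

-- For isotropic x, y with ⟨x,y⟩ ≠ 0 put u = y - x and a = ⟨x,y⟩⁻¹.  In every characteristic the map
-- z ↦ z + a⟨z,u⟩u is an isometry which sends x to y and fixes u^⊥ pointwise.  If ⟨x,y⟩ = 0, one goes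
-- from x to y through an isotropic z perpendicular to neither; z is found by adding a multiple of x to a
-- vector v with ⟨x,v⟩ ≠ 0 ≠ ⟨y,v⟩, because the trace to 𝔽_q is onto.  This gives transitivity on Φ, and,
-- as a vector w with ⟨w,x⟩ = ⟨w,y⟩ can be kept fixed along the way, also transitivity on each S_c, R_c
-- and on T.  A pair in T spans a totally isotropic plane: there is none in dimension 2 or 3, and
-- from dimension 4 on one is built from an element β of norm -1.
module Submission where

open import Defs
open import Algebra.Bundles using (CommutativeSemiring)
import Algebra.Properties.CommutativeSemiring.Binomial as Binomial
import Algebra.Properties.CommutativeSemiring.Exp as CExp
import Algebra.Properties.Ring as RingProps
import Algebra.Properties.Semiring.Mult as Mult
import Algebra.Properties.Semiring.Sum as Sum
import Algebra.Solver.Ring.NaturalCoefficients.Default as SemiringSolver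
open import Data.Fin.Base as Fin using (Fin; zero; suc; toℕ; fromℕ; fromℕ<; inject₁; punchIn; punchOut)
import Data.Fin.Permutation as Perm
import Data.Fin.Properties as Fin
open import Data.Nat.Base as ℕ using (ℕ; zero; suc; _∸_; _≤_; _<_; s≤s; z≤n; _!; NonZero; >-nonZero)
open import Data.Nat.Combinatorics using (_C_; nCn≡1; nCk≡n!/k![n-k]!; k![n∸k]!∣n!)
open import Data.Nat.Divisibility using (_∣_; divides; >⇒∤; m∣m*n; ∣1⇒≡1; m%n≡0⇒n∣m; *-cancelˡ-∣)
open import Data.Nat.DivMod using (_/_; _%_; m/n*n≡m; m≡m%n+[m/n]*n; m%n<n)
open import Data.Nat.Primality using (Prime; euclidsLemma; ¬prime[0]; ¬prime[1])
import Data.Nat.Properties as ℕ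
open import Data.Nat.Tactic.RingSolver using (solve-∀)
open import Data.Product.Base using (Σ; _×_; _,_; proj₁; proj₂; ∃-syntax)
open import Data.Sum.Base using (_⊎_; inj₁; inj₂)
open import Data.Sum.Function.Propositional using (_⊎-↔_)
open import Data.Unit.Base using (⊤; tt)
open import Data.Vec.Functional using (Vector)
import Data.Vec.Functional.Relation.Binary.Equality.Setoid as VecEq
open import Function.Base using (_∘_; case_of_)
open import Function.Bundles using (Inverse; _↔_)
open import Function.Properties.Inverse using (↔-sym; ↔-trans)
open import Relation.Binary.Definitions using (Decidable; tri<; tri≈; tri>)
open import Relation.Binary.PropositionalEquality.Core as ≡ using (_≡_; _≢_)
import Relation.Binary.Reasoning.Setoid as SetoidReasoning
open import Relation.Nullary.Decidable.Core using (Dec; yes; no; map′)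
open import Relation.Nullary.Negation using (¬_; contradiction)
open import Relation.Unary using (_≐_)
open import Relation.Unary.Properties using (≐-refl; ≐-sym; ≐-trans)

-- Explicit isometries take the place of Witt's extension theorem. The basic one fixes `w` once `w`
-- has the same product with both ends, so any intermediate vector must have that product with `w`
-- as well; this constraint separates the cases. For `S` nothing has to be held fixed. For `T` the
-- common product is 0 and the detour must stay orthogonal to `w`; a suitable vector exists there
-- because neither end is a multiple of `w`. For `R` the product is nonzero, and the intermediate
-- vector is sought in the plane of the two given vectors, with a coefficient from a nonzero element
-- of trace zero. The field is known only by its order and a generator `α`, so the arithmetic of
-- `conj` rests on two counts. Adding 1 permutes the q² elements, which gives the characteristic and
-- makes `conj` additive. The powers of `α` exhaust the nonzero elements, so `α` has period exactly
-- q² - 1; hence `conj` is an involution, moves `α`, and has -1 among its norms.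

-- Additivity of the Frobenius map

prime∤! : ∀ {p} → Prime p → ∀ k → k < p → ¬ p ∣ k !
prime∤! pr zero k<p p∣1 = ¬prime[1] (≡.subst Prime (∣1⇒≡1 p∣1) pr)
prime∤! pr (suc k) k<p p∣k! with euclidsLemma (suc k) (k !) pr p∣k!
... | inj₁ p∣1+k = >⇒∤ k<p p∣1+k
... | inj₂ p∣k!′ = prime∤! pr k (ℕ.<-trans (ℕ.n<1+n k) k<p) p∣k!′

-- `p` divides `p !`, the product of the binomial coefficient with two factorials whose factors all
-- lie below `p`.
prime∣C : ∀ {p} → Prime p → ∀ k → 0 < k → k < p → p ∣ p C k
prime∣C {zero} pr = contradiction pr ¬prime[0]
prime∣C {p@(suc p-1)} pr k 0<k k<p
  with euclidsLemma (p C k) (k ! ℕ.* (p ∸ k) !) pr (≡.subst (p ∣_) (≡.sym C*≡p!) (m∣m*n (p-1 !)))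
  where
  instance _ = ℕ._!*_!≢0 k (p ∸ k)
  C*≡p! : (p C k) ℕ.* (k ! ℕ.* (p ∸ k) !) ≡ p !
  C*≡p! = ≡.trans (≡.cong (ℕ._* (k ! ℕ.* (p ∸ k) !)) (nCk≡n!/k![n-k]! (ℕ.<⇒≤ k<p)))
                  (m/n*n≡m (k![n∸k]!∣n! (ℕ.<⇒≤ k<p)))
... | inj₁ p∣C = p∣C
... | inj₂ p∣k![p-k]! with euclidsLemma (k !) ((p ∸ k) !) pr p∣k![p-k]!
...   | inj₁ p∣k! = contradiction p∣k! (prime∤! pr k k<p)
...   | inj₂ p∣[p-k]! = contradiction p∣[p-k]! (prime∤! pr (p ∸ k) (ℕ.∸-monoʳ-< 0<k (ℕ.<⇒≤ k<p)))

module Frobenius {a ℓ} (R : CommutativeSemiring a ℓ) where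

  open CommutativeSemiring R hiding (zero)
  open CExp R
  open Mult semiring renaming (_×_ to _⊗_)
  open Sum semiring
  open SetoidReasoning setoid

  module _ {p : ℕ} (pr : Prime p) (char : p ⊗ 1# ≈ 0#) where

    ∣⇒⊗≈0 : ∀ {m} → p ∣ m → ∀ x → m ⊗ x ≈ 0#
    ∣⇒⊗≈0 (divides k ≡.refl) x = begin
      (k ℕ.* p) ⊗ x          ≈⟨ ×-assocˡ x k p ⟨
      k ⊗ (p ⊗ x)            ≈⟨ ×-congʳ k (×-congʳ p (*-identityˡ x)) ⟨
      k ⊗ (p ⊗ (1# * x))     ≈⟨ ×-congʳ k (×-assoc-* p 1# x) ⟨
      k ⊗ (p ⊗ 1# * x)       ≈⟨ ×-congʳ k (trans (*-congʳ char) (zeroˡ x)) ⟩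
      k ⊗ 0#                 ≈⟨ sum-replicate k ⟨
      _                      ≈⟨ sum-replicate-zero k ⟩
      0#                     ∎

    ^p-distrib-+ : ∀ x y → (x + y) ^ p ≈ x ^ p + y ^ p
    -- `go` takes `p` as an argument together with the facts about it, because the binomial sum
    -- splits off its first and last terms only when `p` is visibly a successor.
    ^p-distrib-+ x y = go p pr (prime∣C pr) ∣⇒⊗≈0
      where
      open Binomial R
      go : ∀ p → Prime p → (∀ k → 0 < k → k < p → p ∣ p C k) →
           (∀ {m} → p ∣ m → ∀ x → m ⊗ x ≈ 0#) → (x + y) ^ p ≈ x ^ p + y ^ p
      go zero pr = contradiction pr ¬prime[0]
      go p@(suc p-1) pr p∣C char′ = begin
        (x + y) ^ p                              ≈⟨ theorem p x y ⟩
        t zero + sum t′                          ≈⟨ +-cong first (sum-init-last t′) ⟩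
        y ^ p + (sum (λ i → t′ (inject₁ i)) + t′ (fromℕ p-1))
                                                 ≈⟨ +-congˡ (+-cong middle last′) ⟩
        y ^ p + (0# + x ^ p)                     ≈⟨ +-congˡ (+-identityˡ _) ⟩
        y ^ p + x ^ p                            ≈⟨ +-comm _ _ ⟩
        x ^ p + y ^ p                            ∎
        where
        t : Fin (suc p) → Carrier
        t = binomialTerm x y p
        t′ : Fin p → Carrier
        t′ i = t (suc i)
        first : t zero ≈ y ^ p
        first = trans (×-homo-1 _) (*-identityˡ _)
        middle : sum (λ i → t′ (inject₁ i)) ≈ 0#
        middle = trans (sum-cong-≋ λ i →
            char′ (p∣C (suc (toℕ (inject₁ i))) (s≤s z≤n)
                     (s≤s (≡.subst (_< p-1) (≡.sym (Fin.toℕ-inject₁ i)) (Fin.toℕ<n i)))) _)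
          (sum-replicate-zero p-1)
        last′ : t′ (fromℕ p-1) ≈ x ^ p
        last′ = begin
          (p C suc (toℕ (fromℕ p-1))) ⊗ (x ^ suc (toℕ (fromℕ p-1)) * y ^ (p ∸ suc (toℕ (fromℕ p-1))))
            ≡⟨ ≡.cong (λ k → (p C suc k) ⊗ (x ^ suc k * y ^ (p ∸ suc k))) (Fin.toℕ-fromℕ p-1) ⟩
          (p C p) ⊗ (x ^ p * y ^ (p ∸ p))
            ≡⟨ ≡.cong₂ (λ c k → c ⊗ (x ^ p * y ^ k)) (nCn≡1 p) (ℕ.n∸n≡0 p) ⟩
          1 ⊗ (x ^ p * 1#)
            ≈⟨ ×-homo-1 _ ⟩
          x ^ p * 1#
            ≈⟨ *-identityʳ _ ⟩
          x ^ p ∎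

    ^p^-distrib-+ : ∀ k x y → (x + y) ^ (p ℕ.^ k) ≈ x ^ (p ℕ.^ k) + y ^ (p ℕ.^ k)
    ^p^-distrib-+ zero x y = trans (*-identityʳ _) (sym (+-cong (*-identityʳ _) (*-identityʳ _)))
    ^p^-distrib-+ (suc k) x y = begin
      (x + y) ^ (p ℕ.* p ℕ.^ k)                       ≈⟨ ^-assocʳ (x + y) p (p ℕ.^ k) ⟨
      ((x + y) ^ p) ^ (p ℕ.^ k)                       ≈⟨ ^-congˡ (p ℕ.^ k) (^p-distrib-+ x y) ⟩
      (x ^ p + y ^ p) ^ (p ℕ.^ k)                     ≈⟨ ^p^-distrib-+ k (x ^ p) (y ^ p) ⟩
      (x ^ p) ^ (p ℕ.^ k) + (y ^ p) ^ (p ℕ.^ k)       ≈⟨ +-cong (^-assocʳ x p _) (^-assocʳ y p _) ⟩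
      x ^ (p ℕ.* p ℕ.^ k) + y ^ (p ℕ.* p ℕ.^ k)       ∎

-- Finite fields: characteristic and powers of a primitive element

module FieldProperties {ℓ m} (F : FiniteField ℓ m) where

  open FiniteField F hiding (zero; invertible; _^_) public
  open CExp commutativeSemiring public
  open Mult semiring using (×1-homo-*) renaming (_×_ to _⊗_)
  open Sum semiring public
    using (sum; sum-cong-≋; sum-permute; sum-remove; sum-replicate; sum-replicate-zero; ∑-distrib-+; *-distribˡ-sum)
  open RingProps ring public
    using (-‿involutive; -‿distribˡ-*; x∙y⁻¹≈ε⇒x≈y; -0#≈0#; -1*x≈-x; +-inverseʳ-unique; +-cancelˡ; +-cancelʳ)
  open SetoidReasoning setoid
  private module ord = Inverse order

  to-injective : ∀ {x y} → ord.to x ≡ ord.to y → x ≈ y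
  to-injective {x} {y} eq =
    trans (sym (ord.strictlyInverseʳ x)) (trans (ord.from-cong eq) (ord.strictlyInverseʳ y))

  infix 4 _≟_
  _≟_ : Decidable _≈_
  x ≟ y = map′ to-injective ord.to-cong (ord.to x Fin.≟ ord.to y)

  inv : ∀ x → x ≉ 0# → Carrier
  inv x x≉0 = proj₁ (FiniteField.invertible F x x≉0)

  *-inverseˡ : ∀ {x} (x≉0 : x ≉ 0#) → inv x x≉0 * x ≈ 1#
  *-inverseˡ {x} x≉0 = proj₁ (proj₂ (FiniteField.invertible F x x≉0))

  *-inverseʳ : ∀ {x} (x≉0 : x ≉ 0#) → x * inv x x≉0 ≈ 1#
  *-inverseʳ {x} x≉0 = proj₂ (proj₂ (FiniteField.invertible F x x≉0))

  *-cancelˡ-≉0 : ∀ {x y z} → x ≉ 0# → x * y ≈ x * z → y ≈ z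
  *-cancelˡ-≉0 {x} {y} {z} x≉0 eq = begin
    y                    ≈⟨ *-identityˡ y ⟨
    1# * y               ≈⟨ *-congʳ (*-inverseˡ x≉0) ⟨
    inv x x≉0 * x * y    ≈⟨ *-assoc _ x y ⟩
    inv x x≉0 * (x * y)  ≈⟨ *-congˡ eq ⟩
    inv x x≉0 * (x * z)  ≈⟨ *-assoc _ x z ⟨
    inv x x≉0 * x * z    ≈⟨ *-congʳ (*-inverseˡ x≉0) ⟩
    1# * z               ≈⟨ *-identityˡ z ⟩
    z                    ∎

  x*y≈0⇒y≈0 : ∀ {x y} → x ≉ 0# → x * y ≈ 0# → y ≈ 0#
  x*y≈0⇒y≈0 {x} x≉0 xy≈0 = *-cancelˡ-≉0 x≉0 (trans xy≈0 (sym (zeroʳ x)))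

  *-≉0 : ∀ {x y} → x ≉ 0# → y ≉ 0# → x * y ≉ 0#
  *-≉0 x≉0 y≉0 xy≈0 = y≉0 (x*y≈0⇒y≈0 x≉0 xy≈0)

  ^-≉0 : ∀ {x} k → x ≉ 0# → x ^ k ≉ 0#
  ^-≉0 zero x≉0 = 1≉0
  ^-≉0 (suc k) x≉0 = *-≉0 x≉0 (^-≉0 k x≉0)

  -x≈0⇒x≈0 : ∀ {x} → - x ≈ 0# → x ≈ 0#
  -x≈0⇒x≈0 {x} -x≈0 = trans (sym (-‿involutive x)) (trans (-‿cong -x≈0) -0#≈0#)

  1^n≈1 : ∀ k → 1# ^ k ≈ 1#
  1^n≈1 zero = refl
  1^n≈1 (suc k) = trans (*-identityˡ _) (1^n≈1 k)

  sum-zero : ∀ {k} {f : Vector Carrier k} → (∀ i → f i ≈ 0#) → sum f ≈ 0#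
  sum-zero {k} f≈0 = trans (sum-cong-≋ f≈0) (sum-replicate-zero k)

  -- Translation by 1 permutes the field, so Σ x ≈ Σ (x + 1) ≈ Σ x + m ⊗ 1.
  m⊗1≈0 : m ⊗ 1# ≈ 0#
  m⊗1≈0 = +-cancelˡ (sum ord.from) _ _ (begin
    sum ord.from + m ⊗ 1#                  ≈⟨ +-congˡ (sum-replicate m) ⟨
    sum ord.from + sum {m} (λ _ → 1#)      ≈⟨ ∑-distrib-+ ord.from (λ _ → 1#) ⟨
    sum (λ i → ord.from i + 1#)            ≈⟨ sum-cong-≋ {m} (λ i → sym (ord.strictlyInverseʳ (ord.from i + 1#))) ⟩
    sum (λ i → ord.from (shift i))         ≈⟨ sum-permute ord.from (Perm.permutation shift unshift shift-unshift unshift-shift) ⟨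
    sum ord.from                           ≈⟨ +-identityʳ _ ⟨
    sum ord.from + 0#                      ∎)
    where
    shift unshift : Fin m → Fin m
    shift i = ord.to (ord.from i + 1#)
    unshift i = ord.to (ord.from i + - 1#)
    x+y+z≈x : ∀ {x y z} → y + z ≈ 0# → x + y + z ≈ x
    x+y+z≈x y+z≈0 = trans (+-assoc _ _ _) (trans (+-congˡ y+z≈0) (+-identityʳ _))
    shift-unshift : ∀ i → shift (unshift i) ≡ i
    shift-unshift i = ≡.trans
      (ord.to-cong (trans (+-congʳ (ord.strictlyInverseʳ _)) (x+y+z≈x (-‿inverseˡ 1#))))
      (ord.strictlyInverseˡ i)
    unshift-shift : ∀ i → unshift (shift i) ≡ i
    unshift-shift i = ≡.trans
      (ord.to-cong (trans (+-congʳ (ord.strictlyInverseʳ _)) (x+y+z≈x (-‿inverseʳ 1#))))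
      (ord.strictlyInverseˡ i)

  -- The multiple `(p ℕ.^ k) ⊗ 1#` is the `k`-th power of `p ⊗ 1#`, and a field has no nilpotents.
  -- This turns the order of the field into its characteristic.
  p^k⊗1≈0⇒p⊗1≈0 : ∀ p k → (p ℕ.^ k) ⊗ 1# ≈ 0# → p ⊗ 1# ≈ 0#
  p^k⊗1≈0⇒p⊗1≈0 p zero eq = contradiction (trans (sym (+-identityʳ 1#)) eq) 1≉0
  p^k⊗1≈0⇒p⊗1≈0 p (suc k) eq with p ⊗ 1# ≟ 0#
  ... | yes p⊗1≈0 = p⊗1≈0
  ... | no p⊗1≉0 = p^k⊗1≈0⇒p⊗1≈0 p k (x*y≈0⇒y≈0 p⊗1≉0 (trans (sym (×1-homo-* p (p ℕ.^ k))) eq))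

  module Primitive {α : Carrier} (α-primitive : IsPrimitive α) where

    α≉0 : α ≉ 0#
    α≉0 = proj₁ α-primitive

    α^k≉0 : ∀ k → α ^ k ≉ 0#
    α^k≉0 k = ^-≉0 k α≉0

    ^-quotient : ∀ {i j} → i ≤ j → α ^ i ≈ α ^ j → α ^ (j ∸ i) ≈ 1#
    ^-quotient {i} {j} i≤j eq = *-cancelˡ-≉0 (α^k≉0 i) (begin
      α ^ i * α ^ (j ∸ i)  ≈⟨ ^-homo-* α i (j ∸ i) ⟨
      α ^ (i ℕ.+ (j ∸ i))  ≡⟨ ≡.cong (α ^_) (ℕ.m+[n∸m]≡n i≤j) ⟩
      α ^ j                ≈⟨ eq ⟨
      α ^ i                ≈⟨ *-identityʳ _ ⟨
      α ^ i * 1#           ∎)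

    ^-mod : ∀ {d} .{{_ : NonZero d}} → α ^ d ≈ 1# → ∀ k → α ^ k ≈ α ^ (k % d)
    ^-mod {d} α^d≈1 k = begin
      α ^ k                               ≡⟨ ≡.cong (α ^_) (≡.trans (m≡m%n+[m/n]*n k d) (≡.cong (k % d ℕ.+_) (ℕ.*-comm (k / d) d))) ⟩
      α ^ (k % d ℕ.+ d ℕ.* (k / d))       ≈⟨ ^-homo-* α (k % d) _ ⟩
      α ^ (k % d) * α ^ (d ℕ.* (k / d))   ≈⟨ *-congˡ (^-assocʳ α d (k / d)) ⟨
      α ^ (k % d) * (α ^ d) ^ (k / d)     ≈⟨ *-congˡ (trans (^-congˡ (k / d) α^d≈1) (1^n≈1 (k / d))) ⟩
      α ^ (k % d) * 1#                    ≈⟨ *-identityʳ _ ⟩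
      α ^ (k % d)                         ∎

    -- The field is {0} ∪ {α ^ i | i < d}.
    α^d≈1⇒m≤1+d : ∀ {d} → 0 < d → α ^ d ≈ 1# → m ≤ suc d
    α^d≈1⇒m≤1+d {d} 0<d α^d≈1 = Fin.injective⇒≤ {f = λ i → proj₁ (index (ord.from i))} λ {i} {j} eq →
      ≡.trans (≡.sym (ord.strictlyInverseˡ i)) (≡.trans (ord.to-cong
        (trans (sym (proj₂ (index (ord.from i)))) (trans (reflexive (≡.cong value eq)) (proj₂ (index (ord.from j))))))
        (ord.strictlyInverseˡ j))
      where
      instance _ = >-nonZero 0<d
      value : Fin (suc d) → Carrier
      value zero = 0#
      value (suc i) = α ^ toℕ i
      index : ∀ x → ∃[ i ] value i ≈ x
      index x with x ≟ 0#
      ... | yes x≈0 = zero , sym x≈0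
      ... | no x≉0 with k , x≈α^k ← proj₂ α-primitive x x≉0 =
        suc (fromℕ< (m%n<n k d)) ,
        trans (reflexive (≡.cong (α ^_) (Fin.toℕ-fromℕ< (m%n<n k d)))) (sym (trans x≈α^k (^-mod α^d≈1 k)))

    period : ∃[ d ] (0 < d × d ≤ m ∸ 1 × α ^ d ≈ 1#)
    -- Zero is placed among the first `m` powers of `α`. It collides with none of them, and its
    -- presence lowers the bound on the period from `m` to `m ∸ 1`.
    period with Fin.pigeonhole (ℕ.n<1+n m) (λ { zero → ord.to 0# ; (suc i) → ord.to (α ^ toℕ i) })
    ... | zero  , suc j , _ , eq = contradiction (sym (to-injective eq)) (α^k≉0 (toℕ j))
    ... | suc i , suc j , s≤s i<j , eq =
      toℕ j ∸ toℕ i , ℕ.m<n⇒0<n∸m i<j ,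
      ℕ.≤-trans (ℕ.m∸n≤m (toℕ j) (toℕ i)) (ℕ.<⇒≤pred (Fin.toℕ<n j)) ,
      ^-quotient (ℕ.<⇒≤ i<j) (to-injective eq)

    instance
      m∸1-nonZero : NonZero (m ∸ 1)
      m∸1-nonZero with d , 0<d , d≤m∸1 , _ ← period = >-nonZero (ℕ.<-≤-trans 0<d d≤m∸1)

    1+[m∸1]≡m : suc (m ∸ 1) ≡ m
    1+[m∸1]≡m = lemma m m∸1-nonZero
      where
      lemma : ∀ m → NonZero (m ∸ 1) → suc (m ∸ 1) ≡ m
      lemma (suc m) _ = ≡.refl

    -- The pigeonhole period is at most `m ∸ 1`, and no positive period is smaller, since the powers
    -- of `α` must reach every nonzero element.
    α^[m∸1]≈1 : α ^ (m ∸ 1) ≈ 1#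
    α^[m∸1]≈1 with d , 0<d , d≤m∸1 , α^d≈1 ← period =
      trans (reflexive (≡.cong (α ^_) (ℕ.≤-antisym (ℕ.pred-mono-≤ (α^d≈1⇒m≤1+d 0<d α^d≈1)) d≤m∸1))) α^d≈1

    -- A positive remainder of `k` modulo `m ∸ 1` would be a period that is too short.
    α^k≈1⇒m∸1∣k : ∀ k → α ^ k ≈ 1# → m ∸ 1 ∣ k
    α^k≈1⇒m∸1∣k k α^k≈1 = m%n≡0⇒n∣m k (m ∸ 1) (lemma (k % (m ∸ 1)) ≡.refl)
      where
      lemma : ∀ r → k % (m ∸ 1) ≡ r → k % (m ∸ 1) ≡ 0
      lemma zero eq = eq
      lemma (suc r) eq = contradiction
        (α^d≈1⇒m≤1+d (s≤s z≤n) (trans (reflexive (≡.cong (α ^_) (≡.sym eq))) (trans (sym (^-mod α^[m∸1]≈1 k)) α^k≈1)))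
        (ℕ.<⇒≱ (ℕ.≤-trans (s≤s (≡.subst (_< m ∸ 1) eq (m%n<n k (m ∸ 1)))) (ℕ.≤-reflexive 1+[m∸1]≡m)))

    log : ∀ {x} → x ≉ 0# → ∃[ i ] x ≈ α ^ toℕ {m ∸ 1} i
    log {x} x≉0 with k , x≈α^k ← proj₂ α-primitive x x≉0 =
      fromℕ< (m%n<n k (m ∸ 1)) ,
      trans x≈α^k (trans (^-mod α^[m∸1]≈1 k) (reflexive (≡.cong (α ^_) (≡.sym (Fin.toℕ-fromℕ< (m%n<n k (m ∸ 1)))))))

    α^-≉ : ∀ {i j : Fin (m ∸ 1)} → i Fin.< j → α ^ toℕ i ≉ α ^ toℕ j
    α^-≉ {i} {j} i<j eq = ℕ.<⇒≱
      (ℕ.<-≤-trans (s≤s (ℕ.≤-<-trans (ℕ.m∸n≤m (toℕ j) (toℕ i)) (Fin.toℕ<n j))) (ℕ.≤-reflexive 1+[m∸1]≡m))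
      (α^d≈1⇒m≤1+d (ℕ.m<n⇒0<n∸m i<j) (^-quotient (ℕ.<⇒≤ i<j) eq))

    α^-injective : ∀ {i j : Fin (m ∸ 1)} → α ^ toℕ i ≈ α ^ toℕ j → i ≡ j
    α^-injective {i} {j} eq with Fin.<-cmp i j
    ... | tri≈ _ i≡j _ = i≡j
    ... | tri< i<j _ _ = contradiction eq (α^-≉ i<j)
    ... | tri> _ _ j<i = contradiction (sym eq) (α^-≉ j<i)

    x^m≈x : ∀ x → x ^ m ≈ x
    x^m≈x x = trans (reflexive (≡.cong (x ^_) (≡.sym 1+[m∸1]≡m))) lemma
      where
      lemma : x ^ suc (m ∸ 1) ≈ x
      lemma with x ≟ 0#
      ... | yes x≈0 = trans (*-congʳ x≈0) (trans (zeroˡ _) (sym x≈0))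
      ... | no x≉0 with i , x≈α^i ← log x≉0 = trans (*-congˡ (begin
        x ^ (m ∸ 1)                 ≈⟨ ^-congˡ (m ∸ 1) x≈α^i ⟩
        (α ^ toℕ i) ^ (m ∸ 1)       ≈⟨ ^-assocʳ α (toℕ i) (m ∸ 1) ⟩
        α ^ (toℕ i ℕ.* (m ∸ 1))     ≡⟨ ≡.cong (α ^_) (ℕ.*-comm (toℕ i) (m ∸ 1)) ⟩
        α ^ ((m ∸ 1) ℕ.* toℕ i)     ≈⟨ ^-assocʳ α (m ∸ 1) (toℕ i) ⟨
        (α ^ (m ∸ 1)) ^ toℕ i       ≈⟨ ^-congˡ (toℕ i) α^[m∸1]≈1 ⟩
        1# ^ toℕ i                  ≈⟨ 1^n≈1 (toℕ i) ⟩
        1#                          ∎)) (*-identityʳ x)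

-- Conjugation, trace and norm of the quadratic extension

primePower⇒2≤ : ∀ {q} → IsPrimePower q → 2 ≤ q
primePower⇒2≤ (zero , k , pr , _) = contradiction pr ¬prime[0]
primePower⇒2≤ (1 , k , pr , _) = contradiction pr ¬prime[1]
primePower⇒2≤ (p@(suc (suc _)) , k , pr , ≡.refl) =
  ℕ.≤-trans (s≤s (s≤s z≤n)) (ℕ.m≤m*n p (p ℕ.^ k) {{ℕ.m^n≢0 p k}})

q²-1-factors : ∀ {q} → 2 ≤ q → q ℕ.^ 2 ∸ 1 ≡ (q ∸ 1) ℕ.* suc q
q²-1-factors {suc r} _ = lemma r
  where
  lemma : ∀ r → r ℕ.* 1 ℕ.+ r ℕ.* (suc r ℕ.* 1) ≡ r ℕ.* suc (suc r)
  lemma = solve-∀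

module Conjugation {ℓ q} (q-primePower : IsPrimePower q) (F : FiniteField ℓ (q ℕ.^ 2))
  {α : FiniteField.Carrier F} (α-primitive : FiniteField.IsPrimitive F α) where

  open FieldProperties F public
  open Primitive α-primitive public
  open SetoidReasoning setoid

  conj : Carrier → Carrier
  conj x = x ^ q

  2≤q : 2 ≤ q
  2≤q = primePower⇒2≤ q-primePower

  conj-cong : ∀ {x y} → x ≈ y → conj x ≈ conj y
  conj-cong = ^-congˡ q

  conj-* : ∀ x y → conj (x * y) ≈ conj x * conj y
  conj-* x y = ^-distrib-* x y q

  conj-1 : conj 1# ≈ 1#
  conj-1 = 1^n≈1 q

  -- The order of the field is a power of the prime `p` below `q`, so `p` is the characteristic and
  -- `conj` is an iterate of the Frobenius map.
  conj-+ : ∀ x y → conj (x + y) ≈ conj x + conj y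
  conj-+ x y = let p , k , pr , q≡p^ = q-primePower in
    ≡.subst (λ r → (x + y) ^ r ≈ x ^ r + y ^ r) (≡.sym q≡p^)
      (Frobenius.^p^-distrib-+ commutativeSemiring pr
        (p^k⊗1≈0⇒p⊗1≈0 p (suc k ℕ.* 2) (≡.subst (λ m → Mult._×_ semiring m 1# ≈ 0#)
          (≡.trans (≡.cong (ℕ._^ 2) q≡p^) (ℕ.^-*-assoc p (suc k) 2)) m⊗1≈0))
        (suc k) x y)

  conj-0 : conj 0# ≈ 0#
  conj-0 = +-cancelˡ (conj 0#) _ _ (begin
    conj 0# + conj 0#  ≈⟨ conj-+ 0# 0# ⟨
    conj (0# + 0#)     ≈⟨ conj-cong (+-identityʳ 0#) ⟩
    conj 0#            ≈⟨ +-identityʳ _ ⟨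
    conj 0# + 0#       ∎)

  conj-neg : ∀ x → conj (- x) ≈ - conj x
  conj-neg x = +-inverseʳ-unique (conj x) (conj (- x))
    (trans (sym (conj-+ x (- x))) (trans (conj-cong (-‿inverseʳ x)) conj-0))

  conj-involutive : ∀ x → conj (conj x) ≈ x
  conj-involutive x = begin
    (x ^ q) ^ q       ≈⟨ ^-assocʳ x q q ⟩
    x ^ (q ℕ.* q)     ≡⟨ ≡.cong (λ r → x ^ (q ℕ.* r)) (ℕ.*-identityʳ q) ⟨
    x ^ (q ℕ.^ 2)     ≈⟨ x^m≈x x ⟩
    x                 ∎

  conj-≉0 : ∀ {x} → x ≉ 0# → conj x ≉ 0#
  conj-≉0 = ^-≉0 q

  conj-inv : ∀ {x} (x≉0 : x ≉ 0#) → conj x * conj (inv x x≉0) ≈ 1#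
  conj-inv x≉0 = trans (sym (conj-* _ _)) (trans (conj-cong (*-inverseʳ x≉0)) conj-1)

  norm≈0⇒≈0 : ∀ {x} → x * conj x ≈ 0# → x ≈ 0#
  norm≈0⇒≈0 {x} eq with x ≟ 0#
  ... | yes x≈0 = x≈0
  ... | no x≉0 = contradiction eq (*-≉0 x≉0 (conj-≉0 x≉0))

  -- Otherwise `α` would have period `q ∸ 1`, too short to enumerate the field.
  conj-α≉α : conj α ≉ α
  conj-α≉α eq = ℕ.<⇒≱ 2≤q (ℕ.*-cancelˡ-≤ q q*q≤q*1)
    where
    instance
      _ : NonZero q
      _ = >-nonZero (ℕ.<⇒≤ 2≤q)
    q*q≤q*1 : q ℕ.* q ≤ q ℕ.* 1
    q*q≤q*1 = ≡.subst₂ _≤_ (≡.cong (q ℕ.*_) (ℕ.*-identityʳ q))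
      (≡.trans (ℕ.suc-pred q) (≡.sym (ℕ.*-identityʳ q)))
      (α^d≈1⇒m≤1+d (ℕ.m<n⇒0<n∸m 2≤q)
        (^-quotient {1} {q} (ℕ.<⇒≤ 2≤q) (trans (*-identityʳ α) (sym eq))))

  -- The difference `α - conj α` changes sign under conjugation in every characteristic, and it is
  -- nonzero because conjugation moves `α`.
  skew-element : ∃[ s ] (s ≉ 0# × s + conj s ≈ 0#)
  skew-element = α - conj α , (λ eq → conj-α≉α (sym (x∙y⁻¹≈ε⇒x≈y _ _ eq))) , (begin
    α - conj α + conj (α - conj α)            ≈⟨ +-congˡ (trans (conj-+ _ _) (+-congˡ (conj-neg _))) ⟩
    α - conj α + (conj α - conj (conj α))     ≈⟨ +-congˡ (+-congˡ (-‿cong (conj-involutive α))) ⟩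
    α - conj α + (conj α - α)                 ≈⟨ +-assoc α _ _ ⟩
    α + (- conj α + (conj α - α))             ≈⟨ +-congˡ (+-assoc _ _ _) ⟨
    α + (- conj α + conj α - α)               ≈⟨ +-congˡ (trans (+-congʳ (-‿inverseˡ _)) (+-identityˡ _)) ⟩
    α - α                                     ≈⟨ -‿inverseʳ α ⟩
    0#                                        ∎)

  -- If `1#` and `α` both had trace zero, the first would force characteristic 2, and then the
  -- second would make `conj` fix `α`.
  trace≉0 : ∃[ b ] b + conj b ≉ 0#
  trace≉0 with 1# + conj 1# ≟ 0# | α + conj α ≟ 0#
  ... | no 1+1≉0 | _ = 1# , 1+1≉0
  ... | yes _ | no α+ᾱ≉0 = α , α+ᾱ≉0
  ... | yes 1+1≈0 | yes α+ᾱ≈0 = contradiction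
    (trans (+-inverseʳ-unique α (conj α) α+ᾱ≈0) (sym (+-inverseʳ-unique α α α+α≈0))) conj-α≉α
    where
    α+α≈0 : α + α ≈ 0#
    α+α≈0 = begin
      α + α              ≈⟨ +-cong (*-identityʳ α) (trans (*-congˡ conj-1) (*-identityʳ α)) ⟨
      α * 1# + α * conj 1#  ≈⟨ distribˡ α 1# (conj 1#) ⟨
      α * (1# + conj 1#) ≈⟨ *-congˡ 1+1≈0 ⟩
      α * 0#             ≈⟨ zeroʳ α ⟩
      0#                 ∎

  -- The trace is linear over the elements fixed by `conj`. The quotient `r` of `c` by a nonzero
  -- trace is such an element, because traces are fixed.
  trace-surjective : ∀ {c} → conj c ≈ c → ∃[ t ] t + conj t ≈ c
  trace-surjective {c} c̄≈c with b , τ≉0 ← trace≉0 = r * b , (begin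
    r * b + conj (r * b)     ≈⟨ +-congˡ (trans (conj-* r b) (*-congʳ r̄≈r)) ⟩
    r * b + r * conj b       ≈⟨ distribˡ r b (conj b) ⟨
    r * (b + conj b)         ≈⟨ *-assoc c _ _ ⟩
    c * (inv _ τ≉0 * (b + conj b)) ≈⟨ *-congˡ (*-inverseˡ τ≉0) ⟩
    c * 1#                   ≈⟨ *-identityʳ c ⟩
    c                        ∎)
    where
    τ = b + conj b
    r = c * inv τ τ≉0
    τ̄≈τ : conj τ ≈ τ
    τ̄≈τ = trans (conj-+ _ _) (trans (+-congˡ (conj-involutive b)) (+-comm _ _))
    r̄≈r : conj r ≈ r
    r̄≈r = trans (conj-* _ _) (*-cong c̄≈c (*-cancelˡ-≉0 τ≉0
      (trans (*-congʳ (sym τ̄≈τ)) (trans (conj-inv τ≉0) (sym (*-inverseʳ τ≉0))))))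

  -- Writing -1 = α ^ k, conjugation invariance gives q² - 1 ∣ k (q - 1), so q + 1 ∣ k.
  norm≈-1 : ∃[ β ] 1# + β * conj β ≈ 0#
  norm≈-1 with k , -1≈α^k ← proj₂ α-primitive (- 1#) (λ eq → 1≉0 (-x≈0⇒x≈0 eq)) = root (1+q∣k k -1≈α^k) -1≈α^k
    where
    root : ∀ {k} → suc q ∣ k → - 1# ≈ α ^ k → ∃[ β ] 1# + β * conj β ≈ 0#
    root (divides c ≡.refl) -1≈α^k = α ^ c , trans (+-congˡ (begin
      (α ^ c) ^ suc q      ≈⟨ ^-assocʳ α c (suc q) ⟩
      α ^ (c ℕ.* suc q)    ≈⟨ -1≈α^k ⟨
      - 1#                 ∎)) (-‿inverseʳ 1#)
    1+q∣k : ∀ k → - 1# ≈ α ^ k → suc q ∣ k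
    1+q∣k k -1≈α^k = *-cancelˡ-∣ (q ∸ 1) {{>-nonZero (ℕ.m<n⇒0<n∸m 2≤q)}}
      (≡.subst₂ _∣_ (q²-1-factors 2≤q) kq∸k≡[q∸1]k
        (α^k≈1⇒m∸1∣k _ (^-quotient (ℕ.m≤m*n k q {{>-nonZero (ℕ.<⇒≤ 2≤q)}}) α^k≈α^kq)))
      where
      α^k≈α^kq : α ^ k ≈ α ^ (k ℕ.* q)
      α^k≈α^kq = begin
        α ^ k            ≈⟨ -1≈α^k ⟨
        - 1#             ≈⟨ -‿cong conj-1 ⟨
        - conj 1#        ≈⟨ conj-neg 1# ⟨
        conj (- 1#)      ≈⟨ conj-cong -1≈α^k ⟩
        conj (α ^ k)     ≈⟨ ^-assocʳ α k q ⟩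
        α ^ (k ℕ.* q)    ∎
      kq∸k≡[q∸1]k : k ℕ.* q ∸ k ≡ (q ∸ 1) ℕ.* k
      kq∸k≡[q∸1]k = ≡.trans (≡.cong (k ℕ.* q ∸_) (≡.sym (ℕ.*-identityʳ k)))
        (≡.trans (≡.sym (ℕ.*-distribˡ-∸ k q 1)) (ℕ.*-comm k (q ∸ 1)))

-- The Hermitian space, its isometries and their orbitals

module Geometry {ℓ q} (q-primePower : IsPrimePower q) (F : FiniteField ℓ (q ℕ.^ 2))
  {α : FiniteField.Carrier F} (α-primitive : FiniteField.IsPrimitive F α) (n : ℕ) where

  open Conjugation q-primePower F α-primitive public
  open Unitary q F n public hiding (conj)
  open VecEq setoid public using (_≋_; ≋-refl; ≋-sym; ≋-trans)
  open SemiringSolver commutativeSemiring public using (solve; _:+_; _:*_; _:=_)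
  open SetoidReasoning setoid

  sum-single : ∀ {m} (f : Vector Carrier m) i → (∀ j → j ≢ i → f j ≈ 0#) → sum f ≈ f i
  sum-single f zero f≈0 = trans (+-congˡ (sum-zero λ j → f≈0 (suc j) λ ())) (+-identityʳ _)
  sum-single f (suc i) f≈0 = trans
    (+-cong (f≈0 zero λ ()) (sum-single (f ∘ suc) i λ j j≢i → f≈0 (suc j) (j≢i ∘ Fin.suc-injective)))
    (+-identityˡ _)

  conj-sum : ∀ {m} (f : Vector Carrier m) → conj (sum f) ≈ sum (conj ∘ f)
  conj-sum {zero} f = conj-0
  conj-sum {suc m} f = trans (conj-+ _ _) (+-congˡ (conj-sum (f ∘ suc)))

  -- Vectors and the Hermitian form

  infixl 6 _+ᵛ_
  _+ᵛ_ : V → V → V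
  (x +ᵛ y) k = x k + y k

  sumᵛ : ∀ {m} → Vector V m → V
  sumᵛ v j = sum λ k → v k j

  e : Fin n → V
  e = 1ᴹ

  1ᴹ-diagonal : ∀ i → 1ᴹ i i ≈ 1#
  1ᴹ-diagonal i with i Fin.≟ i
  ... | yes _ = refl
  ... | no i≢i = contradiction ≡.refl i≢i

  1ᴹ-offDiagonal : ∀ {i j} → i ≢ j → 1ᴹ i j ≈ 0#
  1ᴹ-offDiagonal {i} {j} i≢j with i Fin.≟ j
  ... | yes i≡j = contradiction i≡j i≢j
  ... | no _ = refl

  sum-1ᴹ : ∀ (x : V) j → sum (λ k → x k * 1ᴹ k j) ≈ x j
  sum-1ᴹ x j = trans
    (sum-single _ j λ k k≢j → trans (*-congˡ (1ᴹ-offDiagonal k≢j)) (zeroʳ _))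
    (trans (*-congˡ (1ᴹ-diagonal j)) (*-identityʳ _))

  ⟨⟩-cong : ∀ {x x′ y y′} → x ≋ x′ → y ≋ y′ → ⟨ x , y ⟩ ≈ ⟨ x′ , y′ ⟩
  ⟨⟩-cong x≋x′ y≋y′ = sum-cong-≋ λ k → *-cong (x≋x′ k) (conj-cong (y≋y′ k))

  ⟨⟩-+ˡ : ∀ x y z → ⟨ x +ᵛ y , z ⟩ ≈ ⟨ x , z ⟩ + ⟨ y , z ⟩
  ⟨⟩-+ˡ x y z = trans (sum-cong-≋ {n} λ k → distribʳ (conj (z k)) (x k) (y k))
    (∑-distrib-+ (λ k → x k * conj (z k)) (λ k → y k * conj (z k)))

  ⟨⟩-+ʳ : ∀ x y z → ⟨ x , y +ᵛ z ⟩ ≈ ⟨ x , y ⟩ + ⟨ x , z ⟩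
  ⟨⟩-+ʳ x y z = trans (sum-cong-≋ {n} λ k → trans (*-congˡ (conj-+ (y k) (z k))) (distribˡ (x k) _ _))
    (∑-distrib-+ (λ k → x k * conj (y k)) (λ k → x k * conj (z k)))

  ⟨⟩-·ˡ : ∀ c x y → ⟨ c ·ᵛ x , y ⟩ ≈ c * ⟨ x , y ⟩
  ⟨⟩-·ˡ c x y = trans (sum-cong-≋ {n} λ k → *-assoc c (x k) (conj (y k))) (sym (*-distribˡ-sum c λ k → x k * conj (y k)))

  ⟨⟩-·ʳ : ∀ c x y → ⟨ x , c ·ᵛ y ⟩ ≈ conj c * ⟨ x , y ⟩
  ⟨⟩-·ʳ c x y = trans
    (sum-cong-≋ λ k → trans (*-congˡ (conj-* _ _))
      (solve 3 (λ a b d → a :* (b :* d) := b :* (a :* d)) refl (x k) (conj c) (conj (y k))))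
    (sym (*-distribˡ-sum (conj c) λ k → x k * conj (y k)))

  conj-⟨⟩ : ∀ x y → conj ⟨ x , y ⟩ ≈ ⟨ y , x ⟩
  conj-⟨⟩ x y = trans (conj-sum λ k → x k * conj (y k)) (sum-cong-≋ {n} λ k →
    trans (conj-* (x k) (conj (y k))) (trans (*-congˡ (conj-involutive (y k))) (*-comm (conj (x k)) (y k))))

  ⟨⟩-0ˡ : ∀ {x} y → x ≋ 0ᵛ → ⟨ x , y ⟩ ≈ 0#
  ⟨⟩-0ˡ y x≋0 = sum-zero λ k → trans (*-congʳ (x≋0 k)) (zeroˡ _)

  ⟨⟩-sumˡ : ∀ {m} (v : Vector V m) y → ⟨ sumᵛ v , y ⟩ ≈ sum (λ k → ⟨ v k , y ⟩)
  ⟨⟩-sumˡ {zero} v y = ⟨⟩-0ˡ y λ _ → refl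
  ⟨⟩-sumˡ {suc m} v y = trans (⟨⟩-+ˡ (v zero) (sumᵛ (v ∘ suc)) y) (+-congˡ (⟨⟩-sumˡ (v ∘ suc) y))

  ⟨⟩-eʳ : ∀ x k → ⟨ x , e k ⟩ ≈ x k
  ⟨⟩-eʳ x k = trans
    (sum-single _ k λ j j≢k → trans (*-congˡ (trans (conj-cong (1ᴹ-offDiagonal (j≢k ∘ ≡.sym))) conj-0)) (zeroʳ _))
    (trans (*-congˡ (trans (conj-cong (1ᴹ-diagonal k)) conj-1)) (*-identityʳ _))

  ⊥-sym : ∀ {x y} → ⟨ x , y ⟩ ≈ 0# → ⟨ y , x ⟩ ≈ 0#
  ⊥-sym {x} {y} eq = trans (sym (conj-⟨⟩ x y)) (trans (conj-cong eq) conj-0)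

  ∃≉0 : ∀ (x : V) → ¬ x ≋ 0ᵛ → ∃[ k ] x k ≉ 0#
  ∃≉0 x = Fin.¬∀⟶∃¬ n (λ k → x k ≈ 0#) (λ k → x k ≟ 0#)

  -- Elements of GU(n,q) as linear isometries

  record IsLinear (f : V → V) : Set ℓ where
    field
      cong   : ∀ {x y} → x ≋ y → f x ≋ f y
      +-homo : ∀ x y → f (x +ᵛ y) ≋ f x +ᵛ f y
      ·-homo : ∀ c x → f (c ·ᵛ x) ≋ c ·ᵛ f x

    0-homo : f 0ᵛ ≋ 0ᵛ
    0-homo = ≋-trans (cong λ k → sym (zeroˡ 0#)) (≋-trans (·-homo 0# 0ᵛ) λ k → zeroˡ _)

    sum-homo : ∀ {m} (v : Vector V m) → f (sumᵛ v) ≋ sumᵛ (f ∘ v)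
    sum-homo {zero} v = 0-homo
    sum-homo {suc m} v j = trans (+-homo (v zero) (sumᵛ (v ∘ suc)) j) (+-congˡ (sum-homo (v ∘ suc) j))

    matrix-apply : ∀ x j → sum (λ k → x k * f (e k) j) ≈ f x j
    matrix-apply x j = begin
      sum (λ k → x k * f (e k) j)        ≈⟨ sum-cong-≋ (λ k → sym (·-homo (x k) (e k) j)) ⟩
      sumᵛ (λ k → f (x k ·ᵛ e k)) j      ≈⟨ sum-homo (λ k → x k ·ᵛ e k) j ⟨
      f (sumᵛ (λ k → x k ·ᵛ e k)) j      ≈⟨ cong (sum-1ᴹ x) j ⟩
      f x j                              ∎

  -- Group elements are built and composed as maps; `toGU` reads off a matrix only at the end. The
  -- inverse is carried along because `GU` asks for an inverse matrix.
  record Isometry : Set ℓ where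
    field
      to from     : V → V
      to-linear   : IsLinear to
      from-linear : IsLinear from
      to-from     : ∀ x → to (from x) ≋ x
      from-to     : ∀ x → from (to x) ≋ x
      preserves   : ∀ x y → ⟨ to x , to y ⟩ ≈ ⟨ x , y ⟩

    open IsLinear to-linear public
    open IsLinear from-linear public using () renaming (cong to from-cong)

    injective : ∀ {x y} → to x ≋ to y → x ≋ y
    injective {x} {y} eq = ≋-trans (≋-sym (from-to x)) (≋-trans (from-cong eq) (from-to y))

    toGU : GU
    toGU = record
      { matrix     = λ k → to (e k)
      ; invertible = (λ k → from (e k))
                   , (λ i j → trans (IsLinear.matrix-apply to-linear (from (e i)) j) (to-from (e i) j))
                   , (λ i j → trans (IsLinear.matrix-apply from-linear (to (e i)) j) (from-to (e i) j))
      -- An entry of `matrix *ᴹ conjTranspose matrix` is, by definition, the form of two rows, and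
      -- the rows are the images of the basis vectors.
      ; unitary    = λ i j → trans (preserves (e i) (e j)) (⟨⟩-eʳ (e i) j)
      }

    ·-toGU : ∀ x → x · toGU ≋ to x
    ·-toGU = matrix-apply

  infixr 9 _∘ᵢ_
  _∘ᵢ_ : Isometry → Isometry → Isometry
  σ ∘ᵢ τ = record
    { to          = λ x → σ.to (τ.to x)
    ; from        = λ x → τ.from (σ.from x)
    ; to-linear   = linear σ.to-linear τ.to-linear
    ; from-linear = linear τ.from-linear σ.from-linear
    ; to-from     = λ x → ≋-trans (σ.cong (τ.to-from (σ.from x))) (σ.to-from x)
    ; from-to     = λ x → ≋-trans (τ.from-cong (σ.from-to (τ.to x))) (τ.from-to x)
    ; preserves   = λ x y → trans (σ.preserves (τ.to x) (τ.to y)) (τ.preserves x y)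
    }
    where
    module σ = Isometry σ
    module τ = Isometry τ
    linear : ∀ {f g} → IsLinear f → IsLinear g → IsLinear (f ∘ g)
    linear f-linear g-linear = record
      { cong   = λ eq → f.cong (g.cong eq)
      ; +-homo = λ x y → ≋-trans (f.cong (g.+-homo x y)) (f.+-homo _ _)
      ; ·-homo = λ c x → ≋-trans (f.cong (g.·-homo c x)) (f.·-homo c _)
      }
      where
      module f = IsLinear f-linear
      module g = IsLinear g-linear

  module _ (U : GU) where
    open GU U

    ·-+ : ∀ x y → (x +ᵛ y) · U ≋ (x · U) +ᵛ (y · U)
    ·-+ x y j = trans (sum-cong-≋ {n} λ k → distribʳ (matrix k j) (x k) (y k))
      (∑-distrib-+ (λ k → x k * matrix k j) (λ k → y k * matrix k j))

    ·-·ᵛ : ∀ c x → (c ·ᵛ x) · U ≋ c ·ᵛ (x · U)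
    ·-·ᵛ c x j = trans (sum-cong-≋ {n} λ k → *-assoc c (x k) (matrix k j)) (sym (*-distribˡ-sum c λ k → x k * matrix k j))

    ·-cong : ∀ {x y} → x ≋ y → x · U ≋ y · U
    ·-cong x≋y j = sum-cong-≋ λ k → *-congʳ (x≋y k)

    ·-isometric : ∀ x y → ⟨ x · U , y · U ⟩ ≈ ⟨ x , y ⟩
    ·-isometric x y = trans (expand x (y · U)) (sum-cong-≋ λ k → *-congˡ (begin
      ⟨ matrix k , y · U ⟩               ≈⟨ conj-⟨⟩ (y · U) (matrix k) ⟨
      conj ⟨ y · U , matrix k ⟩          ≈⟨ conj-cong (expand y (matrix k)) ⟩
      conj (sum λ l → y l * ⟨ matrix l , matrix k ⟩)
                                         ≈⟨ conj-cong (sum-cong-≋ λ l → *-congˡ (unitary l k)) ⟩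
      conj (sum λ l → y l * 1ᴹ l k)      ≈⟨ conj-cong (sum-1ᴹ y k) ⟩
      conj (y k)                         ∎))
      where
      expand : ∀ x z → ⟨ x · U , z ⟩ ≈ sum (λ k → x k * ⟨ matrix k , z ⟩)
      expand x z = trans (⟨⟩-sumˡ (λ k → x k ·ᵛ matrix k) z) (sum-cong-≋ λ k → ⟨⟩-·ˡ (x k) (matrix k) z)

    -- The coordinates of `x` are its products with the basis vectors, and these products survive in
    -- the images.
    ·-kernel : ∀ {x} → x · U ≋ 0ᵛ → x ≋ 0ᵛ
    ·-kernel {x} xU≋0 k = begin
      x k                      ≈⟨ ⟨⟩-eʳ x k ⟨
      ⟨ x , e k ⟩              ≈⟨ ·-isometric x (e k) ⟨
      ⟨ x · U , e k · U ⟩      ≈⟨ ⟨⟩-0ˡ (e k · U) xU≋0 ⟩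
      0#                       ∎

  -- Quasi-reflections

  -- A transvection when `u` is isotropic; allowing any `u` treats both kinds of map uniformly.
  shear : Carrier → V → V → V
  shear a u z = z +ᵛ (a * ⟨ z , u ⟩) ·ᵛ u

  shear-linear : ∀ a u → IsLinear (shear a u)
  shear-linear a u = record
    { cong   = λ x≋y k → +-cong (x≋y k) (*-congʳ (*-congˡ (⟨⟩-cong x≋y ≋-refl)))
    ; +-homo = λ x y k → trans (+-congˡ (*-congʳ (*-congˡ (⟨⟩-+ˡ x y u))))
        (solve 6 (λ x y a h l u → (x :+ y) :+ a :* (h :+ l) :* u := (x :+ a :* h :* u) :+ (y :+ a :* l :* u))
          refl (x k) (y k) a ⟨ x , u ⟩ ⟨ y , u ⟩ (u k))
    ; ·-homo = λ c x k → trans (+-congˡ (*-congʳ (*-congˡ (⟨⟩-·ˡ c x u))))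
        (solve 5 (λ c x a h u → c :* x :+ a :* (c :* h) :* u := c :* (x :+ a :* h :* u))
          refl c (x k) a ⟨ x , u ⟩ (u k))
    }

  -- Two shears along the same `u` compose to the shear with coefficient
  -- `a + b + a * b * ⟨ u , u ⟩`.
  shear-inverse : ∀ {a b u} → a + b + a * b * ⟨ u , u ⟩ ≈ 0# → ∀ z → shear b u (shear a u z) ≋ z
  shear-inverse {a} {b} {u} eq z k = begin
    z k + a * h * u k + b * ⟨ shear a u z , u ⟩ * u k
      ≈⟨ +-congˡ (*-congʳ (*-congˡ (trans (⟨⟩-+ˡ z _ u) (+-congˡ (⟨⟩-·ˡ (a * h) u u))))) ⟩
    z k + a * h * u k + b * (h + a * h * ⟨ u , u ⟩) * u k
      ≈⟨ solve 6 (λ z a b h u w → z :+ a :* h :* u :+ b :* (h :+ a :* h :* w) :* u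
                                 := z :+ (a :+ b :+ a :* b :* w) :* (h :* u))
           refl (z k) a b h (u k) ⟨ u , u ⟩ ⟩
    z k + (a + b + a * b * ⟨ u , u ⟩) * (h * u k)
      ≈⟨ +-congˡ (trans (*-congʳ eq) (zeroˡ _)) ⟩
    z k + 0#
      ≈⟨ +-identityʳ _ ⟩
    z k ∎
    where h = ⟨ z , u ⟩

  -- The adjoint of a shear is the shear with coefficient `conj a`; the hypothesis says that this
  -- adjoint is the inverse.
  shear-preserves : ∀ {a u} → a + conj a + a * conj a * ⟨ u , u ⟩ ≈ 0# →
                    ∀ z y → ⟨ shear a u z , shear a u y ⟩ ≈ ⟨ z , y ⟩
  shear-preserves {a} {u} eq z y = begin
    ⟨ z +ᵛ c ·ᵛ u , shear a u y ⟩
      ≈⟨ trans (⟨⟩-+ˡ z _ _) (+-congˡ (⟨⟩-·ˡ c u _)) ⟩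
    ⟨ z , shear a u y ⟩ + c * ⟨ u , shear a u y ⟩
      ≈⟨ +-cong (⟨-,shear⟩ z) (*-congˡ (⟨-,shear⟩ u)) ⟩
    ⟨ z , y ⟩ + conj a * k * h + a * h * (k + conj a * k * ⟨ u , u ⟩)
      ≈⟨ solve 6 (λ zy a b h k w → zy :+ b :* k :* h :+ a :* h :* (k :+ b :* k :* w)
                                  := zy :+ (a :+ b :+ a :* b :* w) :* (h :* k))
           refl ⟨ z , y ⟩ a (conj a) h k ⟨ u , u ⟩ ⟩
    ⟨ z , y ⟩ + (a + conj a + a * conj a * ⟨ u , u ⟩) * (h * k)
      ≈⟨ +-congˡ (trans (*-congʳ eq) (zeroˡ _)) ⟩
    ⟨ z , y ⟩ + 0#
      ≈⟨ +-identityʳ _ ⟩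
    ⟨ z , y ⟩ ∎
    where
    h = ⟨ z , u ⟩
    k = ⟨ u , y ⟩
    c = a * h
    ⟨-,shear⟩ : ∀ v → ⟨ v , shear a u y ⟩ ≈ ⟨ v , y ⟩ + conj a * k * ⟨ v , u ⟩
    ⟨-,shear⟩ v = trans (⟨⟩-+ʳ v y _) (+-congˡ (trans (⟨⟩-·ʳ _ v u)
      (*-congʳ (trans (conj-* a _) (*-congˡ (conj-⟨⟩ y u))))))

  reflection : ∀ a u → a + conj a + a * conj a * ⟨ u , u ⟩ ≈ 0# → Isometry
  reflection a u eq = record
    { to          = shear a u
    ; from        = shear (conj a) u
    ; to-linear   = shear-linear a u
    ; from-linear = shear-linear (conj a) u
    ; to-from     = shear-inverse (trans (+-cong (+-comm _ _) (*-congʳ (*-comm _ _))) eq)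
    ; from-to     = shear-inverse eq
    ; preserves   = shear-preserves eq
    }

  -- Moving isotropic vectors

  open Isometry using (to)

  infix 4 _⟼_fixing_
  _⟼_fixing_ : V → V → V → Set ℓ
  x ⟼ y fixing w = ∃[ σ ] (to σ x ≋ y × to σ w ≋ w)

  ⟼-trans : ∀ {x y z w} → x ⟼ y fixing w → y ⟼ z fixing w → x ⟼ z fixing w
  ⟼-trans (σ , σx≋y , σw≋w) (τ , τy≋z , τw≋w) =
    τ ∘ᵢ σ , ≋-trans (Isometry.cong τ σx≋y) τy≋z , ≋-trans (Isometry.cong τ σw≋w) τw≋w

  x+-1*x≈0 : ∀ x → x + - 1# * x ≈ 0#
  x+-1*x≈0 x = trans (+-congˡ (-1*x≈-x x)) (-‿inverseʳ x)

  conj--1 : conj (- 1#) ≈ - 1#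
  conj--1 = trans (conj-neg 1#) (-‿cong conj-1)

  -- Here `⟨ u , u ⟩` is minus the trace of `h`. Divided by `a * conj a`, the unitarity condition
  -- asks that the inverse of `a` have the same trace as `h`, so the inverse of `h` serves as `a`.
  -- As `⟨ x , u ⟩ ≈ h`, exactly one copy of `u` is then added to `x`.
  isotropic-⟼ : ∀ {x y w} → ⟨ x , x ⟩ ≈ 0# → ⟨ y , y ⟩ ≈ 0# → ⟨ x , y ⟩ ≉ 0# →
                ⟨ w , x ⟩ ≈ ⟨ w , y ⟩ → x ⟼ y fixing w
  isotropic-⟼ {x} {y} {w} xx≈0 yy≈0 h≉0 wx≈wy = reflection a u unitary , x⟼y , w⟼w
    where
    h = ⟨ x , y ⟩
    a = inv h h≉0
    -- Subtraction is written with the scalar `- 1#`, which the semiring solver can treat as an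
    -- atom.
    u = y +ᵛ - 1# ·ᵛ x
    ⟨-,u⟩ : ∀ z → ⟨ z , u ⟩ ≈ ⟨ z , y ⟩ + - 1# * ⟨ z , x ⟩
    ⟨-,u⟩ z = trans (⟨⟩-+ʳ z y _) (+-congˡ (trans (⟨⟩-·ʳ (- 1#) z x) (*-congʳ conj--1)))
    ⟨x,u⟩≈h : ⟨ x , u ⟩ ≈ h
    ⟨x,u⟩≈h = trans (⟨-,u⟩ x) (trans (+-congˡ (trans (*-congˡ xx≈0) (zeroʳ _))) (+-identityʳ _))
    ⟨y,u⟩≈-h̄ : ⟨ y , u ⟩ ≈ - 1# * conj h
    ⟨y,u⟩≈-h̄ = trans (⟨-,u⟩ y) (trans (+-cong yy≈0 (*-congˡ (sym (conj-⟨⟩ x y)))) (+-identityˡ _))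
    ⟨u,u⟩ : ⟨ u , u ⟩ ≈ - 1# * conj h + - 1# * h
    ⟨u,u⟩ = trans (⟨⟩-+ˡ y _ u) (+-cong ⟨y,u⟩≈-h̄ (trans (⟨⟩-·ˡ (- 1#) x u) (*-congˡ ⟨x,u⟩≈h)))
    regroup : ∀ a b m h k → a + b + a * b * (m * k + m * h) ≈ (a + m * (a * (k * b))) + (b + m * (b * (h * a)))
    regroup = solve 5 (λ a b m h k → a :+ b :+ a :* b :* (m :* k :+ m :* h)
                                   := (a :+ m :* (a :* (k :* b))) :+ (b :+ m :* (b :* (h :* a)))) refl
    unitary : a + conj a + a * conj a * ⟨ u , u ⟩ ≈ 0#
    unitary = begin
      a + conj a + a * conj a * ⟨ u , u ⟩
        ≈⟨ +-congˡ (*-congˡ ⟨u,u⟩) ⟩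
      a + conj a + a * conj a * (- 1# * conj h + - 1# * h)
        ≈⟨ regroup a (conj a) (- 1#) h (conj h) ⟩
      (a + - 1# * (a * (conj h * conj a))) + (conj a + - 1# * (conj a * (h * a)))
        ≈⟨ +-cong (+-congˡ (*-congˡ (trans (*-congˡ (conj-inv h≉0)) (*-identityʳ _))))
                  (+-congˡ (*-congˡ (trans (*-congˡ (*-inverseʳ h≉0)) (*-identityʳ _)))) ⟩
      (a + - 1# * a) + (conj a + - 1# * conj a)
        ≈⟨ +-cong (x+-1*x≈0 a) (x+-1*x≈0 (conj a)) ⟩
      0# + 0#
        ≈⟨ +-identityʳ 0# ⟩
      0# ∎
    x⟼y : shear a u x ≋ y
    x⟼y k = begin
      x k + a * ⟨ x , u ⟩ * u k       ≈⟨ +-congˡ (*-congʳ (trans (*-congˡ ⟨x,u⟩≈h) (*-inverseˡ h≉0))) ⟩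
      x k + 1# * u k                  ≈⟨ +-congˡ (*-identityˡ _) ⟩
      x k + (y k + - 1# * x k)        ≈⟨ solve 3 (λ x y z → x :+ (y :+ z) := (x :+ z) :+ y) refl (x k) (y k) (- 1# * x k) ⟩
      x k + - 1# * x k + y k          ≈⟨ +-congʳ (x+-1*x≈0 (x k)) ⟩
      0# + y k                        ≈⟨ +-identityˡ _ ⟩
      y k                             ∎
    w⟼w : shear a u w ≋ w
    w⟼w k = trans (+-congˡ (trans (*-congʳ (trans (*-congˡ
        (trans (⟨-,u⟩ w) (trans (+-congʳ (sym wx≈wy)) (x+-1*x≈0 _)))) (zeroʳ a))) (zeroˡ _)))
      (+-identityʳ _)

  -- Since `x` is isotropic, adding `t ·ᵛ x` changes `⟨ v , v ⟩` by the trace of `t * ⟨ x , v ⟩`.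
  -- The value to be cancelled is fixed by `conj`, hence is a trace.
  isotropic-lift : ∀ {x} v → ⟨ x , x ⟩ ≈ 0# → ⟨ x , v ⟩ ≉ 0# →
                   ∃[ t ] ⟨ v +ᵛ t ·ᵛ x , v +ᵛ t ·ᵛ x ⟩ ≈ 0#
  isotropic-lift {x} v xx≈0 h≉0
    with s , s+s̄≈-vv ← trace-surjective (trans (conj-neg ⟨ v , v ⟩) (-‿cong (conj-⟨⟩ v v))) = t , (begin
    ⟨ z , z ⟩
      ≈⟨ trans (⟨⟩-+ˡ v _ z) (+-congˡ (⟨⟩-·ˡ t x z)) ⟩
    ⟨ v , z ⟩ + t * ⟨ x , z ⟩
      ≈⟨ +-cong (⟨-,z⟩ v) (*-congˡ (⟨-,z⟩ x)) ⟩
    (⟨ v , v ⟩ + conj t * ⟨ v , x ⟩) + t * (h + conj t * ⟨ x , x ⟩)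
      ≈⟨ +-cong (+-congˡ t̄⟨v,x⟩≈s̄) (trans (*-congˡ (trans (+-congˡ (trans (*-congˡ xx≈0) (zeroʳ _))) (+-identityʳ h))) th≈s) ⟩
    (⟨ v , v ⟩ + conj s) + s
      ≈⟨ trans (+-assoc _ _ _) (+-congˡ (+-comm _ _)) ⟩
    ⟨ v , v ⟩ + (s + conj s)
      ≈⟨ trans (+-congˡ s+s̄≈-vv) (-‿inverseʳ _) ⟩
    0# ∎)
    where
    h = ⟨ x , v ⟩
    t = s * inv h h≉0
    z = v +ᵛ t ·ᵛ x
    th≈s : t * h ≈ s
    th≈s = trans (*-assoc _ _ _) (trans (*-congˡ (*-inverseˡ h≉0)) (*-identityʳ s))
    t̄⟨v,x⟩≈s̄ : conj t * ⟨ v , x ⟩ ≈ conj s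
    t̄⟨v,x⟩≈s̄ = trans (*-congˡ (sym (conj-⟨⟩ x v))) (trans (sym (conj-* t h)) (conj-cong th≈s))
    ⟨-,z⟩ : ∀ w → ⟨ w , z ⟩ ≈ ⟨ w , v ⟩ + conj t * ⟨ w , x ⟩
    ⟨-,z⟩ w = trans (⟨⟩-+ʳ w v _) (+-congˡ (⟨⟩-·ʳ t w x))

  ≈0+≉0⇒≉0 : ∀ {x y} → x ≈ 0# → y ≉ 0# → x + y ≉ 0#
  ≈0+≉0⇒≉0 x≈0 y≉0 eq = y≉0 (trans (sym (trans (+-congʳ x≈0) (+-identityˡ _))) eq)

  ⟨⟩-+·ʳ : ∀ {w x} v t → ⟨ w , x ⟩ ≈ 0# → ⟨ w , v +ᵛ t ·ᵛ x ⟩ ≈ ⟨ w , v ⟩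
  ⟨⟩-+·ʳ {w} {x} v t wx≈0 = trans (⟨⟩-+ʳ w v _)
    (trans (+-congˡ (trans (⟨⟩-·ʳ t w x) (trans (*-congˡ wx≈0) (zeroʳ _)))) (+-identityʳ _))

  -- By nondegeneracy this amounts to `x` not being a multiple of `w`, but it comes with the vector
  -- from which a detour orthogonal to `w` is built.
  Supports : V → V → Set ℓ
  Supports w x = ∃[ v ] (⟨ w , v ⟩ ≈ 0# × ⟨ x , v ⟩ ≉ 0#)

  -- A space is not the union of two proper subspaces: when each witness fails for the other vector,
  -- their sum works for both.
  common-support : ∀ {w x y} → Supports w x → Supports w y →
                   ∃[ v ] (⟨ w , v ⟩ ≈ 0# × ⟨ x , v ⟩ ≉ 0# × ⟨ y , v ⟩ ≉ 0#)
  common-support {w} {x} {y} (v₁ , wv₁≈0 , xv₁≉0) (v₂ , wv₂≈0 , yv₂≉0)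
    with ⟨ y , v₁ ⟩ ≟ 0# | ⟨ x , v₂ ⟩ ≟ 0#
  ... | no yv₁≉0 | _ = v₁ , wv₁≈0 , xv₁≉0 , yv₁≉0
  ... | yes _ | no xv₂≉0 = v₂ , wv₂≈0 , xv₂≉0 , yv₂≉0
  ... | yes yv₁≈0 | yes xv₂≈0 = v₁ +ᵛ v₂
    , trans (⟨⟩-+ʳ w v₁ v₂) (trans (+-cong wv₁≈0 wv₂≈0) (+-identityʳ 0#))
    , (λ eq → ≈0+≉0⇒≉0 xv₂≈0 xv₁≉0 (trans (+-comm _ _) (trans (sym (⟨⟩-+ʳ x v₁ v₂)) eq)))
    , (λ eq → ≈0+≉0⇒≉0 yv₁≈0 yv₂≉0 (trans (sym (⟨⟩-+ʳ y v₁ v₂)) eq))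

  -- In the detour `x` is orthogonal to `w`, to `y` and to itself, so adding a multiple of it makes
  -- `v` isotropic without changing the products of `v` with these three.
  perpendicular-⟼ : ∀ {x y w} → ⟨ x , x ⟩ ≈ 0# → ⟨ y , y ⟩ ≈ 0# →
                    ⟨ w , x ⟩ ≈ 0# → ⟨ w , y ⟩ ≈ 0# → Supports w x → Supports w y → x ⟼ y fixing w
  perpendicular-⟼ {x} {y} {w} xx≈0 yy≈0 wx≈0 wy≈0 w-x w-y = case ⟨ x , y ⟩ ≟ 0# of λ where
      (no xy≉0)  → isotropic-⟼ {x} {y} {w} xx≈0 yy≈0 xy≉0 (trans wx≈0 (sym wy≈0))
      (yes xy≈0) → detour xy≈0 (common-support {w} {x} {y} w-x w-y)
    where
    detour : ⟨ x , y ⟩ ≈ 0# → ∃[ v ] (⟨ w , v ⟩ ≈ 0# × ⟨ x , v ⟩ ≉ 0# × ⟨ y , v ⟩ ≉ 0#) → x ⟼ y fixing w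
    detour xy≈0 (v , wv≈0 , xv≉0 , yv≉0) = ⟼-trans {x} {z} {y} {w}
      (isotropic-⟼ {x} {z} {w} xx≈0 zz≈0
        (λ eq → xv≉0 (trans (sym (⟨⟩-+·ʳ {x} {x} v t xx≈0)) eq)) (trans wx≈0 (sym wz≈0)))
      (isotropic-⟼ {z} {y} {w} zz≈0 yy≈0
        (λ eq → yv≉0 (trans (sym (⟨⟩-+·ʳ {y} {x} v t (⊥-sym {x} {y} xy≈0))) (⊥-sym {z} {y} eq))) (trans wz≈0 (sym wy≈0)))
      where
      t = proj₁ (isotropic-lift {x} v xx≈0 xv≉0)
      zz≈0 = proj₂ (isotropic-lift {x} v xx≈0 xv≉0)
      z = v +ᵛ t ·ᵛ x
      wz≈0 : ⟨ w , z ⟩ ≈ 0#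
      wz≈0 = trans (⟨⟩-+·ʳ {w} {x} v t wx≈0) wv≈0

  support : ∀ {x} → ¬ x ≋ 0ᵛ → ∃[ v ] ⟨ x , v ⟩ ≉ 0#
  support {x} x≉0 with k , xₖ≉0 ← ∃≉0 x x≉0 = e k , λ eq → xₖ≉0 (trans (sym (⟨⟩-eʳ x k)) eq)

  ⟨0,-⟩ : ∀ v → ⟨ 0ᵛ , v ⟩ ≈ 0#
  ⟨0,-⟩ v = ⟨⟩-0ˡ v λ _ → refl

  -- Fixing the zero vector is no constraint, so `0ᵛ` takes the place of `w`.
  ⟼-transitive : ∀ {x y} → ¬ x ≋ 0ᵛ → ⟨ x , x ⟩ ≈ 0# → ¬ y ≋ 0ᵛ → ⟨ y , y ⟩ ≈ 0# → ∃[ σ ] to σ x ≋ y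
  ⟼-transitive {x} {y} x≉0 xx≈0 y≉0 yy≈0
    with v , xv≉0 ← support x≉0 | v′ , yv′≉0 ← support y≉0
    with σ , σx≋y , _ ← perpendicular-⟼ {x} {y} {0ᵛ} xx≈0 yy≈0 (⟨0,-⟩ x) (⟨0,-⟩ y) (v , ⟨0,-⟩ v , xv≉0) (v′ , ⟨0,-⟩ v′ , yv′≉0) =
    σ , σx≋y
  -- If ⟨y,y′⟩ = 0, the intermediate vector is z = y + t x with t ⟨x,y⟩ = s ≠ 0 of trace zero: then z is
  -- isotropic, ⟨x,z⟩ = ⟨x,y⟩ and ⟨z,y⟩ = ⟨z,y′⟩ = s.
  hyperbolic-⟼ : ∀ {x y y′} → ⟨ x , x ⟩ ≈ 0# → ⟨ y , y ⟩ ≈ 0# → ⟨ y′ , y′ ⟩ ≈ 0# →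
                 ⟨ x , y ⟩ ≉ 0# → ⟨ x , y ⟩ ≈ ⟨ x , y′ ⟩ → y ⟼ y′ fixing x
  hyperbolic-⟼ {x} {y} {y′} xx≈0 yy≈0 y′y′≈0 c≉0 xy≈xy′ with ⟨ y , y′ ⟩ ≟ 0#
  ... | no yy′≉0 = isotropic-⟼ {y} {y′} {x} yy≈0 y′y′≈0 yy′≉0 xy≈xy′
  ... | yes yy′≈0 with s , s≉0 , s+s̄≈0 ← skew-element =
    ⟼-trans {y = z}
      (isotropic-⟼ {y} {z} {x} yy≈0 zz≈0 (λ eq → s≉0 (trans (sym zy≈s) (⊥-sym {y} {z} eq))) (sym xz≈xy))
      (isotropic-⟼ {z} {y′} {x} zz≈0 y′y′≈0 (λ eq → s≉0 (trans (sym zy′≈s) eq)) (trans xz≈xy xy≈xy′))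
    where
    c = ⟨ x , y ⟩
    t = s * inv c c≉0
    z = y +ᵛ t ·ᵛ x
    tc≈s : t * c ≈ s
    tc≈s = trans (*-assoc _ _ _) (trans (*-congˡ (*-inverseˡ c≉0)) (*-identityʳ s))
    xz≈xy : ⟨ x , z ⟩ ≈ c
    xz≈xy = ⟨⟩-+·ʳ {x} {x} y t xx≈0
    ⟨z,-⟩ : ∀ w → ⟨ z , w ⟩ ≈ ⟨ y , w ⟩ + t * ⟨ x , w ⟩
    ⟨z,-⟩ w = trans (⟨⟩-+ˡ y _ w) (+-congˡ (⟨⟩-·ˡ t x w))
    zy≈s : ⟨ z , y ⟩ ≈ s
    zy≈s = trans (⟨z,-⟩ y) (trans (+-cong yy≈0 tc≈s) (+-identityˡ s))
    zy′≈s : ⟨ z , y′ ⟩ ≈ s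
    zy′≈s = trans (⟨z,-⟩ y′) (trans (+-cong yy′≈0 (trans (*-congˡ (sym xy≈xy′)) tc≈s)) (+-identityˡ s))
    zz≈0 : ⟨ z , z ⟩ ≈ 0#
    zz≈0 = trans (⟨z,-⟩ z) (trans (+-cong
      (trans (sym (conj-⟨⟩ z y)) (conj-cong zy≈s)) (trans (*-congˡ xz≈xy) tc≈s)) (trans (+-comm _ _) s+s̄≈0))

  -- Linear dependence

  Span : V → V → Set ℓ
  Span x y = ∃[ c ] y ≋ c ·ᵛ x

  ratio : ∀ {x : V} {k} (y : V) → x k ≉ 0# → Carrier
  ratio {x} {k} y xₖ≉0 = y k * inv (x k) xₖ≉0

  span⇒≋ratio : ∀ {x y k} (xₖ≉0 : x k ≉ 0#) → Span x y → y ≋ ratio {x} y xₖ≉0 ·ᵛ x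
  span⇒≋ratio {x} {y} {k} xₖ≉0 (c , y≋cx) j = trans (y≋cx j) (*-congʳ (begin
    c                            ≈⟨ *-identityʳ c ⟨
    c * 1#                       ≈⟨ *-congˡ (*-inverseʳ xₖ≉0) ⟨
    c * (x k * inv _ xₖ≉0)       ≈⟨ *-assoc _ _ _ ⟨
    c * x k * inv _ xₖ≉0         ≈⟨ *-congʳ (y≋cx k) ⟨
    y k * inv _ xₖ≉0             ∎))

  -- The only possible coefficient is the ratio at a nonzero coordinate of `x`, so one candidate is
  -- tested. This decision is what makes the classification of pairs exhaustive.
  span? : ∀ {x} → ¬ x ≋ 0ᵛ → ∀ y → Dec (Span x y)
  span? {x} x≉0 y with k , xₖ≉0 ← ∃≉0 x x≉0 =
    map′ (λ eq → ratio {x} y xₖ≉0 , eq) (span⇒≋ratio xₖ≉0) (Fin.all? λ j → y j ≟ ratio {x} y xₖ≉0 * x j)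

  -- Some coordinate `l` violates proportionality. The functional `z l + d * z k` then kills `x` but
  -- not `y`; it is the product with `v`, whose coefficient is conjugated because the form is
  -- conjugate-linear on the right.
  ¬span⇒supports : ∀ {x y} → ¬ x ≋ 0ᵛ → ¬ Span x y → Supports x y
  ¬span⇒supports {x} {y} x≉0 y∉⟨x⟩
    with k , xₖ≉0 ← ∃≉0 x x≉0
    with l , yₗ≉ ← Fin.¬∀⟶∃¬ n _ (λ j → y j ≟ ratio {x} y xₖ≉0 * x j) (λ eq → y∉⟨x⟩ (_ , eq)) =
    v , xv≈0 , λ yv≈0 → yₗ≉ (x∙y⁻¹≈ε⇒x≈y _ _ (trans (+-congˡ yₗ-part) (trans (sym (⟨-,v⟩ y)) yv≈0)))
    where
    x⁻ = inv (x k) xₖ≉0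
    d = - (x l * x⁻)
    v = e l +ᵛ conj d ·ᵛ e k
    ⟨-,v⟩ : ∀ z → ⟨ z , v ⟩ ≈ z l + d * z k
    ⟨-,v⟩ z = trans (⟨⟩-+ʳ z (e l) _)
      (+-cong (⟨⟩-eʳ z l) (trans (⟨⟩-·ʳ (conj d) z (e k)) (*-cong (conj-involutive d) (⟨⟩-eʳ z k))))
    xv≈0 : ⟨ x , v ⟩ ≈ 0#
    xv≈0 = trans (⟨-,v⟩ x) (trans (+-congˡ (trans (sym (-‿distribˡ-* _ _)) (-‿cong
      (trans (*-assoc _ _ _) (trans (*-congˡ (*-inverseˡ xₖ≉0)) (*-identityʳ _)))))) (-‿inverseʳ _))
    yₗ-part : - (y k * x⁻ * x l) ≈ d * y k
    yₗ-part = trans (-‿cong (solve 3 (λ a b c → a :* b :* c := c :* b :* a) refl (y k) x⁻ (x l))) (-‿distribˡ-* _ _)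

  ⟨⟩-span : ∀ {x y} → ⟨ x , x ⟩ ≈ 0# → Span x y → ⟨ x , y ⟩ ≈ 0#
  ⟨⟩-span {x} xx≈0 (c , y≋cx) = trans (⟨⟩-cong ≋-refl y≋cx)
    (trans (⟨⟩-·ʳ c x x) (trans (*-congˡ xx≈0) (zeroʳ _)))

  -- Orbitals

  isometry⇒orbit : ∀ (p p′ : Φ × Φ) (σ : Isometry) →
                   to σ (proj₁ (proj₁ p)) ≋ proj₁ (proj₁ p′) → to σ (proj₁ (proj₂ p)) ≋ proj₁ (proj₂ p′) →
                   orbit p p′
  isometry⇒orbit ((x , _) , (y , _)) p′ σ σx≋x′ σy≋y′ =
    Isometry.toGU σ , ≋-trans (Isometry.·-toGU σ x) σx≋x′ , ≋-trans (Isometry.·-toGU σ y) σy≋y′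

  isTransitive : IsTransitive
  isTransitive (x , x≉0 , xx≈0) (y , y≉0 , yy≈0) with ⟼-transitive {x} {y} x≉0 xx≈0 y≉0 yy≈0
  ... | σ , σx≋y = Isometry.toGU σ , ≋-trans (Isometry.·-toGU σ x) σx≋y

  record IsOrbitRelation (A : Relation) : Set ℓ where
    field
      inhabited  : ∃[ p ] A p
      invariant  : ∀ p p′ → orbit p p′ → A p → A p′
      transitive : ∀ p p′ → A p → A p′ → orbit p p′

    ≐orbit : ∀ p → A p → A ≐ orbit p
    ≐orbit p p∈A = (λ {p′} p′∈A → transitive p p′ p∈A p′∈A) , (λ {p′} p⇝p′ → invariant p p′ p⇝p′ p∈A)

  module _ {I : Set} (A : I → Relation) (A-orbit : ∀ i → IsOrbitRelation (A i))
    (cover : ∀ p → ∃[ i ] A i p) (disjoint : ∀ i j p → A i p → A j p → i ≡ j) where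

    private module A i = IsOrbitRelation (A-orbit i)

    orbitalsAreExactly : OrbitalsAreExactly A
    orbitalsAreExactly = record
      { isOrbital = λ i → proj₁ (A.inhabited i) , A.≐orbit i _ (proj₂ (A.inhabited i))
      ; complete  = λ O (p , O≐orbit) → proj₁ (cover p) ,
          ≐-trans {i = O} {j = orbit p} O≐orbit
            (≐-sym {x = A (proj₁ (cover p))} (A.≐orbit (proj₁ (cover p)) p (proj₂ (cover p))))
      ; distinct  = λ i j Ai≐Aj → disjoint i j _ (proj₂ (A.inhabited i)) (proj₁ Ai≐Aj (proj₂ (A.inhabited i)))
      }

  hasRank : ∀ {I : Set} {A : I → Relation} {m} → OrbitalsAreExactly A → I ↔ Fin m → HasRank m
  hasRank {I} {A} {m} exact I↔Fin = record
    { to        = λ (O , O-orbital) → index.to (proj₁ (complete O O-orbital))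
    ; from      = λ i → A (index.from i) , isOrbital (index.from i)
    ; to-cong   = λ { {O , O-orbital} {O′ , O′-orbital} O≐O′ → ≡.cong index.to (distinct _ _
        (≐-trans {j = O} (≐-sym {x = O} (proj₂ (complete O O-orbital)))
          (≐-trans {j = O′} O≐O′ (proj₂ (complete O′ O′-orbital))))) }
    ; from-cong = λ { {i} ≡.refl → ≐-refl {x = A (index.from i)} }
    ; inverse   =
        (λ { {i} {O , O-orbital} O≐Ai → ≡.trans (≡.cong index.to (distinct _ _
          (≐-trans {j = O} (≐-sym {x = O} (proj₂ (complete O O-orbital))) O≐Ai)))
          (index.strictlyInverseˡ i) })
      , (λ { {O , O-orbital} ≡.refl → ≐-sym {x = O}
          (≡.subst (λ i → O ≐ A i) (≡.sym (index.strictlyInverseʳ _)) (proj₂ (complete O O-orbital))) })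
    }
    where
    open OrbitalsAreExactly exact
    module index = Inverse I↔Fin

  ·-injective : ∀ U {x y} → x · U ≋ y · U → x ≋ y
  ·-injective U {x} {y} xU≋yU k = x∙y⁻¹≈ε⇒x≈y _ _ (trans (+-congˡ (sym (-1*x≈-x (y k)))) (x-y≋0 k))
    where
    x-y≋0 : x +ᵛ - 1# ·ᵛ y ≋ 0ᵛ
    x-y≋0 = ·-kernel U {x +ᵛ - 1# ·ᵛ y} λ j → begin
      ((x +ᵛ - 1# ·ᵛ y) · U) j           ≈⟨ ·-+ U x (- 1# ·ᵛ y) j ⟩
      (x · U) j + ((- 1# ·ᵛ y) · U) j    ≈⟨ +-cong (xU≋yU j) (·-·ᵛ U (- 1#) y j) ⟩
      (y · U) j + - 1# * (y · U) j       ≈⟨ x+-1*x≈0 _ ⟩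
      0#                                 ∎

  orbit-⟨⟩ : ∀ p p′ → orbit p p′ →
             ⟨ proj₁ (proj₁ p′) , proj₁ (proj₂ p′) ⟩ ≈ ⟨ proj₁ (proj₁ p) , proj₁ (proj₂ p) ⟩
  orbit-⟨⟩ ((x , _) , (y , _)) ((x′ , _) , (y′ , _)) (U , xU≋x′ , yU≋y′) =
    trans (⟨⟩-cong {x′} {x · U} {y′} {y · U} (≋-sym xU≋x′) (≋-sym yU≋y′)) (·-isometric U x y)

  scale : ∀ {c} → c ≉ 0# → Φ → Φ
  scale {c} c≉0 (x , x≉0 , xx≈0) = c ·ᵛ x
    , (λ cx≋0 → x≉0 λ k → x*y≈0⇒y≈0 c≉0 (cx≋0 k))
    , trans (⟨⟩-·ˡ c x (c ·ᵛ x)) (trans (*-congˡ (⟨⟩-span {x} {c ·ᵛ x} xx≈0 (c , ≋-refl))) (zeroʳ c))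

  S-isOrbit : ∀ {c} → Φ → c ≉ 0# → IsOrbitRelation (S c)
  S-isOrbit {c} x₀ c≉0 = record
    { inhabited  = (x₀ , scale c≉0 x₀) , ≋-refl
    ; invariant  = λ { ((x , _) , (y , _)) ((x′ , _) , (y′ , _)) (U , xU≋x′ , yU≋y′) y≋cx k →
        trans (sym (yU≋y′ k)) (trans (·-cong U y≋cx k) (trans (·-·ᵛ U c x k) (*-congˡ (xU≋x′ k)))) }
    ; transitive = λ { p@((x , x≉0 , xx≈0) , (y , _)) p′@((x′ , x′≉0 , x′x′≈0) , (y′ , _)) y≋cx y′≋cx′ →
        let σ , σx≋x′ = ⟼-transitive {x} {x′} x≉0 xx≈0 x′≉0 x′x′≈0
        in isometry⇒orbit p p′ σ σx≋x′ λ k →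
             trans (Isometry.cong σ y≋cx k) (trans (Isometry.·-homo σ c x k)
               (trans (*-congˡ (σx≋x′ k)) (sym (y′≋cx′ k)))) }
    }

  -- Once x is moved to x′, it remains to move the image of y to y′ while fixing x′.
  orbit-via-stabiliser : ∀ (p p′ : Φ × Φ) → let (x , _) , (y , _) = p ; (x′ , _) , (y′ , _) = p′ in
    (∀ σ → to σ x ≋ x′ → to σ y ⟼ y′ fixing x′) → orbit p p′
  orbit-via-stabiliser p@((x , x≉0 , xx≈0) , (y , _)) p′@((x′ , x′≉0 , x′x′≈0) , (y′ , _)) move =
    let σ , σx≋x′ = ⟼-transitive {x} {x′} x≉0 xx≈0 x′≉0 x′x′≈0
        τ , τσy≋y′ , τx′≋x′ = move σ σx≋x′
    in isometry⇒orbit p p′ (τ ∘ᵢ σ) (≋-trans (Isometry.cong τ σx≋x′) τx′≋x′) τσy≋y′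

  isometry-⟨⟩ : ∀ σ {x x′} y → to σ x ≋ x′ → ⟨ x′ , to σ y ⟩ ≈ ⟨ x , y ⟩
  isometry-⟨⟩ σ {x} {x′} y σx≋x′ = trans (⟨⟩-cong (≋-sym σx≋x′) ≋-refl) (Isometry.preserves σ x y)

  hyperbolic-partner : ∀ {c} → c ≉ 0# → ((x , _) : Φ) → Σ Φ λ (y , _) → ⟨ x , y ⟩ ≈ c
  hyperbolic-partner {c} c≉0 (x , x≉0 , xx≈0) =
    (y , (λ y≋0 → c≉0 (trans (sym xy≈c) (⊥-sym {y} {x} (⟨⟩-0ˡ x y≋0)))) , yy≈0) , xy≈c
    where
    v = proj₁ (support x≉0)
    xv≉0 = proj₂ (support x≉0)
    lift = isotropic-lift {x} v xx≈0 xv≉0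
    z = v +ᵛ proj₁ lift ·ᵛ x
    xz≈xv : ⟨ x , z ⟩ ≈ ⟨ x , v ⟩
    xz≈xv = ⟨⟩-+·ʳ {x} {x} v (proj₁ lift) xx≈0
    d = c * inv ⟨ x , v ⟩ xv≉0
    -- The form conjugates scalars of its second argument, so `conj d` contributes the factor `d`.
    y = conj d ·ᵛ z
    xy≈c : ⟨ x , y ⟩ ≈ c
    xy≈c = begin
      ⟨ x , conj d ·ᵛ z ⟩                            ≈⟨ ⟨⟩-·ʳ (conj d) x z ⟩
      conj (conj d) * ⟨ x , z ⟩                      ≈⟨ *-cong (conj-involutive d) xz≈xv ⟩
      c * inv ⟨ x , v ⟩ xv≉0 * ⟨ x , v ⟩             ≈⟨ *-assoc _ _ _ ⟩
      c * (inv ⟨ x , v ⟩ xv≉0 * ⟨ x , v ⟩)           ≈⟨ *-congˡ (*-inverseˡ xv≉0) ⟩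
      c * 1#                                         ≈⟨ *-identityʳ c ⟩
      c                                              ∎
    yy≈0 : ⟨ y , y ⟩ ≈ 0#
    yy≈0 = trans (⟨⟩-·ˡ (conj d) z y) (trans (*-congˡ (⟨⟩-span {z} {y} (proj₂ lift) (conj d , ≋-refl))) (zeroʳ _))

  R-isOrbit : ∀ {c} → Φ → c ≉ 0# → IsOrbitRelation (R c)
  R-isOrbit {c} x₀ c≉0 = record
    { inhabited  = let y , xy≈c = hyperbolic-partner c≉0 x₀ in (x₀ , y) , xy≈c
    ; invariant  = λ p p′ p⇝p′ xy≈c → trans (orbit-⟨⟩ p p′ p⇝p′) xy≈c
    ; transitive = λ { p@((x , x≉0 , xx≈0) , (y , _ , yy≈0)) p′@((x′ , x′≉0 , x′x′≈0) , (y′ , _ , y′y′≈0)) xy≈c x′y′≈c →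
        orbit-via-stabiliser p p′ λ σ σx≋x′ →
          let x′σy≈c = trans (isometry-⟨⟩ σ {x} {x′} y σx≋x′) xy≈c
          in hyperbolic-⟼ {x′} {to σ y} {y′} x′x′≈0 (trans (Isometry.preserves σ y y) yy≈0) y′y′≈0
               (λ eq → c≉0 (trans (sym x′σy≈c) eq)) (trans x′σy≈c (sym x′y′≈c)) }
    }

  T-isOrbit : ∃[ p ] T p → IsOrbitRelation T
  T-isOrbit inhabited = record
    { inhabited  = inhabited
    ; invariant  = λ { p@((x , _) , (y , _)) p′@((x′ , _) , (y′ , _)) p⇝p′@(U , xU≋x′ , yU≋y′) (xy≈0 , y∉⟨x⟩) →
        trans (orbit-⟨⟩ p p′ p⇝p′) xy≈0 ,
        λ (c , y′≋cx′) → y∉⟨x⟩ (c , ·-injective U λ k →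
          trans (yU≋y′ k) (trans (y′≋cx′ k) (trans (*-congˡ (sym (xU≋x′ k))) (sym (·-·ᵛ U c x k))))) }
    ; transitive = λ { p@((x , x≉0 , xx≈0) , (y , _ , yy≈0)) p′@((x′ , x′≉0 , x′x′≈0) , (y′ , _ , y′y′≈0))
                       (xy≈0 , y∉⟨x⟩) (x′y′≈0 , y′∉⟨x′⟩) →
        orbit-via-stabiliser p p′ λ σ σx≋x′ →
          perpendicular-⟼ {to σ y} {y′} {x′} (trans (Isometry.preserves σ y y) yy≈0) y′y′≈0
            (trans (isometry-⟨⟩ σ {x} {x′} y σx≋x′) xy≈0) x′y′≈0
            -- Independence passes through the injective `σ` and supplies the room orthogonal to
            -- `x′` in which the move takes place.
            (¬span⇒supports x′≉0 λ (c , σy≋cx′) → y∉⟨x⟩ (c , Isometry.injective σ λ k →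
              trans (σy≋cx′ k) (trans (*-congˡ (sym (σx≋x′ k))) (sym (Isometry.·-homo σ c x k)))))
            (¬span⇒supports x′≉0 y′∉⟨x′⟩) }
    }

  S∪R-isOrbit : Φ → ∀ i → IsOrbitRelation (S∪R α i)
  S∪R-isOrbit x₀ (inj₁ i) = S-isOrbit x₀ (α^k≉0 (toℕ i))
  S∪R-isOrbit x₀ (inj₂ i) = R-isOrbit x₀ (α^k≉0 (toℕ i))

  S∪R-disjoint : ∀ i j p → S∪R α i p → S∪R α j p → i ≡ j
  S∪R-disjoint (inj₁ i) (inj₁ j) ((x , x≉0 , _) , _) y≋αⁱx y≋αʲx =
    let k , xₖ≉0 = ∃≉0 x x≉0 in ≡.cong inj₁ (α^-injective (*-cancelˡ-≉0 xₖ≉0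
      (trans (*-comm _ _) (trans (sym (y≋αⁱx k)) (trans (y≋αʲx k) (*-comm _ _))))))
  S∪R-disjoint (inj₁ i) (inj₂ j) ((x , _ , xx≈0) , (y , _)) y≋αⁱx xy≈αʲ =
    contradiction (trans (sym xy≈αʲ) (⟨⟩-span {x} {y} xx≈0 (_ , y≋αⁱx))) (α^k≉0 (toℕ j))
  S∪R-disjoint (inj₂ i) (inj₁ j) ((x , _ , xx≈0) , (y , _)) xy≈αⁱ y≋αʲx =
    contradiction (trans (sym xy≈αⁱ) (⟨⟩-span {x} {y} xx≈0 (_ , y≋αʲx))) (α^k≉0 (toℕ i))
  S∪R-disjoint (inj₂ i) (inj₂ j) _ xy≈αⁱ xy≈αʲ = ≡.cong inj₂ (α^-injective (trans (sym xy≈αⁱ) xy≈αʲ))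

  T-S∪R-disjoint : ∀ i p → S∪R α i p → ¬ T p
  T-S∪R-disjoint (inj₁ i) p y≋αⁱx (_ , y∉⟨x⟩) = y∉⟨x⟩ (_ , y≋αⁱx)
  T-S∪R-disjoint (inj₂ i) p xy≈αⁱ (xy≈0 , _) = α^k≉0 (toℕ i) (trans (sym xy≈αⁱ) xy≈0)

  classify : ∀ p → (∃[ i ] S∪R α i p) ⊎ T p
  classify ((x , x≉0 , xx≈0) , (y , y≉0 , yy≈0)) = case ⟨ x , y ⟩ ≟ 0# of λ where
      (no xy≉0)  → let i , xy≈αⁱ = log xy≉0 in inj₁ (inj₂ i , xy≈αⁱ)
      (yes xy≈0) → case span? {x} x≉0 y of λ where
        (no y∉⟨x⟩)        → inj₂ (xy≈0 , y∉⟨x⟩)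
        (yes (c , y≋cx)) →
          let i , c≈αⁱ = log {c} λ c≈0 → y≉0 λ k → trans (y≋cx k) (trans (*-congʳ c≈0) (zeroˡ _))
          in inj₁ (inj₁ i , λ k → trans (y≋cx k) (*-congʳ c≈αⁱ))

  S∪R-exact : Φ → (∀ p → ¬ T p) → OrbitalsAreExactly (S∪R α)
  S∪R-exact x₀ T-empty = orbitalsAreExactly (S∪R α) (S∪R-isOrbit x₀)
    (λ p → case classify p of λ { (inj₁ i∈p) → i∈p ; (inj₂ p∈T) → contradiction p∈T (T-empty p) }) S∪R-disjoint

  S∪R∪T-exact : ∃[ p ] T p → OrbitalsAreExactly (S∪R∪T α)
  S∪R∪T-exact inhabited = orbitalsAreExactly (S∪R∪T α)
    (λ { (inj₁ i) → S∪R-isOrbit (proj₁ (proj₁ inhabited)) i ; (inj₂ tt) → T-isOrbit inhabited })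
    (λ p → case classify p of λ { (inj₁ (i , p∈Aᵢ)) → inj₁ i , p∈Aᵢ ; (inj₂ p∈T) → inj₂ tt , p∈T })
    λ { (inj₁ i) (inj₁ j) p p∈Aᵢ p∈Aⱼ → ≡.cong inj₁ (S∪R-disjoint i j p p∈Aᵢ p∈Aⱼ)
      ; (inj₁ i) (inj₂ tt) p p∈Aᵢ p∈T → contradiction p∈T (T-S∪R-disjoint i p p∈Aᵢ)
      ; (inj₂ tt) (inj₁ j) p p∈T p∈Aⱼ → contradiction p∈T (T-S∪R-disjoint j p p∈Aⱼ)
      ; (inj₂ tt) (inj₂ tt) _ _ _ → ≡.refl }

-- Totally isotropic planes and the dependence on the dimension

module WittIndex {ℓ q} (q-primePower : IsPrimePower q) (F : FiniteField ℓ (q ℕ.^ 2))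
  {α : FiniteField.Carrier F} (α-primitive : FiniteField.IsPrimitive F α) where

  open Conjugation q-primePower F α-primitive
  open SemiringSolver commutativeSemiring using (solve; _:+_; _:*_; _:=_)
  open SetoidReasoning setoid
  open Geometry q-primePower F α-primitive using (S∪R-exact; S∪R∪T-exact; isTransitive; hasRank)

  -- In dimension 2 an isotropic vector spans its own orthogonal complement: by the two equations,
  -- `conj z * (b * w)` and `conj z * (d * z)` are both the negative of `conj w * d * w`.
  isotropic-parallel : ∀ {b d z w} → z ≉ 0# → z * conj z + w * conj w ≈ 0# → z * conj b + w * conj d ≈ 0# →
                       b * w ≈ d * z
  isotropic-parallel {b} {d} {z} {w} z≉0 zz+ww≈0 zb+wd≈0 = *-cancelˡ-≉0 (conj-≉0 z≉0)
    (+-cancelʳ (conj w * d * w) _ _ (begin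
      conj z * (b * w) + conj w * d * w
        ≈⟨ solve 5 (λ b d w z̄ w̄ → z̄ :* (b :* w) :+ w̄ :* d :* w := (z̄ :* b :+ w̄ :* d) :* w) refl b d w (conj z) (conj w) ⟩
      (conj z * b + conj w * d) * w
        ≈⟨ *-congʳ (+-cong (conj-*ʳ z b) (conj-*ʳ w d)) ⟨
      (conj (z * conj b) + conj (w * conj d)) * w
        ≈⟨ *-congʳ (trans (sym (conj-+ _ _)) (trans (conj-cong zb+wd≈0) conj-0)) ⟩
      0# * w
        ≈⟨ trans (zeroˡ w) (sym (zeroˡ d)) ⟩
      0# * d
        ≈⟨ *-congʳ zz+ww≈0 ⟨
      (z * conj z + w * conj w) * d
        ≈⟨ solve 5 (λ d z w z̄ w̄ → (z :* z̄ :+ w :* w̄) :* d := z̄ :* (d :* z) :+ w̄ :* d :* w) refl d z w (conj z) (conj w) ⟩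
      conj z * (d * z) + conj w * d * w ∎))
    where
    conj-*ʳ : ∀ x y → conj (x * conj y) ≈ conj x * y
    conj-*ʳ x y = trans (conj-* x (conj y)) (*-congˡ (conj-involutive y))

  isotropic-parallel⇒≈0 : ∀ {b d z w} → z ≉ 0# → z * conj z + w * conj w ≈ 0# → b * w ≈ d * z →
                          b * conj b + d * conj d ≈ 0#
  isotropic-parallel⇒≈0 {b} {d} {z} {w} z≉0 zz+ww≈0 bw≈dz = begin
    b * conj b + d * conj d
      ≈⟨ +-cong (norm b≈rz) (norm d≈rw) ⟩
    r * z * (conj r * conj z) + r * w * (conj r * conj w)
      ≈⟨ regroup r z w (conj r) (conj z) (conj w) ⟩
    r * conj r * (z * conj z + w * conj w)
      ≈⟨ trans (*-congˡ zz+ww≈0) (zeroʳ _) ⟩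
    0# ∎
    where
    r = b * inv z z≉0
    regroup : ∀ r z w r̄ z̄ w̄ → r * z * (r̄ * z̄) + r * w * (r̄ * w̄) ≈ r * r̄ * (z * z̄ + w * w̄)
    regroup = solve 6 (λ r z w r̄ z̄ w̄ → r :* z :* (r̄ :* z̄) :+ r :* w :* (r̄ :* w̄) := r :* r̄ :* (z :* z̄ :+ w :* w̄)) refl
    b≈rz : b ≈ r * z
    b≈rz = sym (trans (*-assoc _ _ _) (trans (*-congˡ (*-inverseˡ z≉0)) (*-identityʳ b)))
    d≈rw : d ≈ r * w
    d≈rw = *-cancelˡ-≉0 z≉0 (begin
      z * d          ≈⟨ *-comm z d ⟩
      d * z          ≈⟨ bw≈dz ⟨
      b * w          ≈⟨ *-congʳ b≈rz ⟩
      r * z * w      ≈⟨ trans (*-congʳ (*-comm r z)) (*-assoc z r w) ⟩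
      z * (r * w)    ∎)
    norm : ∀ {x y} → x ≈ r * y → x * conj x ≈ r * y * (conj r * conj y)
    norm x≈ry = *-cong x≈ry (trans (conj-cong x≈ry) (conj-* r _))

  -- The formula of `⟨_,_⟩` with the dimension implicit, so that vectors with a coordinate removed
  -- can be paired too.
  form : ∀ {m} → Vector Carrier m → Vector Carrier m → Carrier
  form x y = sum λ k → x k * conj (y k)

  -- A totally isotropic plane in dimension m + 1 would be spanned by vectors (c , x) and (0 , z) with
  -- c ≉ 0#, up to the order of the coordinates.
  NoIsotropicPlane : ℕ → Set ℓ
  NoIsotropicPlane m = ∀ {c} (x z : Vector Carrier m) → c ≉ 0# → c * conj c + form x x ≈ 0# →
    form z z ≈ 0# → form z x ≈ 0# → ∀ i → z i ≈ 0#

  noIsotropicPlane₁ : NoIsotropicPlane 1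
  noIsotropicPlane₁ x z _ _ zz≈0 _ zero = norm≈0⇒≈0 (trans (sym (+-identityʳ _)) zz≈0)

  -- If `z₀` is nonzero, `x` is orthogonal to the isotropic `z`, hence parallel to it and isotropic,
  -- which leaves `c` with norm zero. If `z₀` vanishes, `z₁` has norm zero.
  noIsotropicPlane₂ : NoIsotropicPlane 2
  noIsotropicPlane₂ {c} x z c≉0 cc+xx≈0 zz≈0 zx≈0 = case z₀ ≟ 0# of λ where
      (yes z₀≈0) → λ where
        zero → z₀≈0
        (suc zero) → norm≈0⇒≈0 (begin
          z₁ * conj z₁                      ≈⟨ +-identityˡ _ ⟨
          0# + z₁ * conj z₁                 ≈⟨ +-congʳ (trans (*-congʳ z₀≈0) (zeroˡ _)) ⟨
          z₀ * conj z₀ + z₁ * conj z₁       ≈⟨ drop0 zz≈0 ⟩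
          0#                                ∎)
      (no z₀≉0) → contradiction (norm≈0⇒≈0 (begin
        c * conj c                                                ≈⟨ +-identityʳ _ ⟨
        c * conj c + 0#                                           ≈⟨ +-congˡ (isotropic-parallel⇒≈0 z₀≉0 (drop0 zz≈0)
                                                                       (isotropic-parallel z₀≉0 (drop0 zz≈0) (drop0 zx≈0))) ⟨
        c * conj c + (x₀ * conj x₀ + x₁ * conj x₁)                ≈⟨ +-congˡ (+-congˡ (+-identityʳ _)) ⟨
        c * conj c + form x x                                     ≈⟨ cc+xx≈0 ⟩
        0#                                                        ∎)) c≉0
    where
    x₀ = x zero
    x₁ = x (suc zero)
    z₀ = z zero
    z₁ = z (suc zero)
    drop0 : ∀ {a b} → a + (b + 0#) ≈ 0# → a + b ≈ 0#
    drop0 eq = trans (+-congˡ (sym (+-identityʳ _))) eq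

  module _ (m : ℕ) where
    open Geometry q-primePower F α-primitive (suc m)
      using (⟨_,_⟩; T; _+ᵛ_; _·ᵛ_; ∃≉0; ⟨⟩-+ˡ; ⟨⟩-·ˡ; ⟨⟩-+·ʳ; ⊥-sym)

    -- Subtracting from `y` the multiple of `x` that clears a coordinate where `x` is nonzero gives
    -- an isotropic `z` orthogonal to `x`. Without that coordinate `z` keeps its products, so it
    -- must vanish and `y` is a multiple of `x`.
    T-empty : NoIsotropicPlane m → ∀ p → ¬ T p
    T-empty noPlane ((x , x≉0 , xx≈0) , (y , _ , yy≈0)) (xy≈0 , y∉⟨x⟩) = y∉⟨x⟩ (r , y≋rx)
      where
      k = proj₁ (∃≉0 x x≉0)
      xₖ≉0 = proj₂ (∃≉0 x x≉0)
      r = y k * inv (x k) xₖ≉0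
      z = y +ᵛ (- r) ·ᵛ x
      z-expand : ∀ j → z j ≈ y j - r * x j
      z-expand j = +-congˡ (sym (-‿distribˡ-* r (x j)))
      zₖ≈0 : z k ≈ 0#
      zₖ≈0 = trans (z-expand k) (trans (+-congˡ (-‿cong
        (trans (*-assoc _ _ _) (trans (*-congˡ (*-inverseˡ xₖ≉0)) (*-identityʳ _))))) (-‿inverseʳ _))
      ⟨z,-⟩ : ∀ w → ⟨ y , w ⟩ ≈ 0# → ⟨ x , w ⟩ ≈ 0# → ⟨ z , w ⟩ ≈ 0#
      ⟨z,-⟩ w yw≈0 xw≈0 = trans (⟨⟩-+ˡ y ((- r) ·ᵛ x) w)
        (trans (+-cong yw≈0 (trans (⟨⟩-·ˡ (- r) x w) (trans (*-congˡ xw≈0) (zeroʳ _)))) (+-identityʳ 0#))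
      zx≈0 : ⟨ z , x ⟩ ≈ 0#
      zx≈0 = ⟨z,-⟩ x (⊥-sym {x} {y} xy≈0) xx≈0
      zy≈0 : ⟨ z , y ⟩ ≈ 0#
      zy≈0 = ⟨z,-⟩ y yy≈0 xy≈0
      zz≈0 : ⟨ z , z ⟩ ≈ 0#
      zz≈0 = trans (⟨⟩-+·ʳ {z} {x} y (- r) zx≈0) zy≈0
      remove-k : ∀ w → form (z ∘ punchIn k) (w ∘ punchIn k) ≈ ⟨ z , w ⟩
      remove-k w = sym (trans (sum-remove {i = k} (λ j → z j * conj (w j)))
        (trans (+-congʳ (trans (*-congʳ zₖ≈0) (zeroˡ _))) (+-identityˡ _)))
      z≈0 : ∀ j → z j ≈ 0#
      z≈0 j with k Fin.≟ j
      ... | yes ≡.refl = zₖ≈0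
      ... | no k≢j = trans (reflexive (≡.cong z (≡.sym (Fin.punchIn-punchOut k≢j))))
        (noPlane (x ∘ punchIn k) (z ∘ punchIn k) xₖ≉0
          (trans (sym (sum-remove {i = k} (λ j → x j * conj (x j)))) xx≈0)
          (trans (remove-k z) zz≈0) (trans (remove-k x) zx≈0) (punchOut k≢j))
      y≋rx : ∀ j → y j ≈ r * x j
      y≋rx j = x∙y⁻¹≈ε⇒x≈y _ _ (trans (sym (z-expand j)) (z≈0 j))

  module _ (m : ℕ) where

    isotropicPoint : Vector Carrier (suc (suc m))
    isotropicPoint zero = 1#
    isotropicPoint (suc zero) = proj₁ norm≈-1
    isotropicPoint (suc (suc _)) = 0#

    isotropicPoint-isotropic : form isotropicPoint isotropicPoint ≈ 0#
    isotropicPoint-isotropic = trans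
      (+-cong (trans (*-identityˡ _) conj-1)
              (trans (+-congˡ (sum-zero {m} λ i → zeroˡ (conj 0#))) (+-identityʳ _)))
      (proj₂ norm≈-1)

  Φ-inhabited : ∀ m → Unitary.Φ q F (suc (suc m))
  Φ-inhabited m = isotropicPoint m , (λ eq → 1≉0 (eq zero)) , isotropicPoint-isotropic m

  -- Two copies of the isotropic point on disjoint pairs of coordinates are orthogonal and
  -- independent; this takes four coordinates.
  T-inhabited : ∀ m → ∃[ p ] Unitary.T q F (4 ℕ.+ m) p
  T-inhabited m = (Φ-inhabited (2 ℕ.+ m) , y , (λ eq → 1≉0 (eq (suc (suc zero)))) ,
      trans (0*-+ _) (trans (0*-+ _) (isotropicPoint-isotropic m))) ,
    trans (+-cong (x*conj0≈0 _) (trans (+-cong (x*conj0≈0 _)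
      (sum-zero {2 ℕ.+ m} λ i → zeroˡ (conj (y (suc (suc i)))))) (+-identityʳ 0#))) (+-identityʳ 0#) ,
    λ (c , y≋cx) → 1≉0 (trans (y≋cx (suc (suc zero))) (zeroʳ c))
    where
    y : Vector Carrier (4 ℕ.+ m)
    y zero = 0#
    y (suc zero) = 0#
    y (suc (suc i)) = isotropicPoint m i
    0*-+ : ∀ {a} b → 0# * a + b ≈ b
    0*-+ b = trans (+-congʳ (zeroˡ _)) (+-identityˡ b)
    x*conj0≈0 : ∀ x → x * conj 0# ≈ 0#
    x*conj0≈0 x = trans (*-congˡ conj-0) (zeroʳ x)

  -- Counting the orbitals

  private
    N = q ℕ.^ 2 ∸ 1

  S∪R-index : (Fin N ⊎ Fin N) ↔ Fin (2 ℕ.* q ℕ.^ 2 ∸ 2)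
  S∪R-index = ≡.subst (λ k → (Fin N ⊎ Fin N) ↔ Fin k)
    (≡.trans (≡.cong (N ℕ.+_) (≡.sym (ℕ.+-identityʳ N))) (ℕ.*-distribˡ-∸ 2 (q ℕ.^ 2) 1)) (↔-sym Fin.+↔⊎)

  S∪R∪T-index : ((Fin N ⊎ Fin N) ⊎ ⊤) ↔ Fin (2 ℕ.* q ℕ.^ 2 ∸ 1)
  S∪R∪T-index = ≡.subst (λ k → ((Fin N ⊎ Fin N) ⊎ ⊤) ↔ Fin k) (count (q ℕ.^ 2) 1+[m∸1]≡m)
    (↔-trans (↔-sym Fin.+↔⊎ ⊎-↔ ↔-sym Fin.1↔⊤) (↔-sym Fin.+↔⊎))
    where
    -- The hypothesis excludes `m = 0`, where truncated subtraction would give 1 on the left and 0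
    -- on the right.
    count : ∀ m → suc (m ∸ 1) ≡ m → (m ∸ 1 ℕ.+ (m ∸ 1)) ℕ.+ 1 ≡ 2 ℕ.* m ∸ 1
    count (suc k) _ = lemma k
      where
      lemma : ∀ k → (k ℕ.+ k) ℕ.+ 1 ≡ k ℕ.+ suc (k ℕ.+ 0)
      lemma = solve-∀

  small-dimension : ∀ m → NoIsotropicPlane (suc m) → let open Unitary q F (2 ℕ.+ m) in
    OrbitalsAreExactly (S∪R α) × IsTransitive × HasRank (2 ℕ.* q ℕ.^ 2 ∸ 2)
  small-dimension m noPlane = exact , isTransitive (2 ℕ.+ m) , hasRank (2 ℕ.+ m) exact S∪R-index
    where exact = S∪R-exact (2 ℕ.+ m) (Φ-inhabited m) (T-empty (suc m) noPlane)

  large-dimension : ∀ m → let open Unitary q F (4 ℕ.+ m) in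
    OrbitalsAreExactly (S∪R∪T α) × IsTransitive × HasRank (2 ℕ.* q ℕ.^ 2 ∸ 1)
  large-dimension m = exact , isTransitive (4 ℕ.+ m) , hasRank (4 ℕ.+ m) exact S∪R∪T-index
    where exact = S∪R∪T-exact (4 ℕ.+ m) (T-inhabited m)

open import Data.Nat.Base using (_*_; _^_)

theorem2p12 : ∀ {ℓ} (q : ℕ) → IsPrimePower q →
    (F : FiniteField ℓ (q ^ 2)) →
    (α : FiniteField.Carrier F) → FiniteField.IsPrimitive F α →
    (n : ℕ) → let open Unitary q F n in
    ((n ≡ 2 ⊎ n ≡ 3) →
    OrbitalsAreExactly (S∪R α) × IsTransitive × HasRank (2 * q ^ 2 ∸ 2))
    ×
    (4 ≤ n →
    OrbitalsAreExactly (S∪R∪T α) × IsTransitive × HasRank (2 * q ^ 2 ∸ 1))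
theorem2p12 q q-primePower F α α-primitive n =
    (λ { (inj₁ ≡.refl) → small-dimension 0 noIsotropicPlane₁ ; (inj₂ ≡.refl) → small-dimension 1 noIsotropicPlane₂ })
  , (λ { (s≤s (s≤s (s≤s (s≤s {n = m} z≤n)))) → large-dimension m })
  where open WittIndex q-primePower F α-primitive
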